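{- Assuming the Orthogonal Vectors Conjecture, for any constant $\epsilon>0$ there is no algorithm that, given any straight-line grammar (SLG) $G=(V,\Sigma,R,S)$ representing a string $T\in\Sigma^{N}$, where $\Sigma=\{1,\ldots,\sigma\}$ and $\sigma=\Omega((N/\log N)^{1/2})$, answers any batch of $m=\Omega(|G|/\log N)$ range mode frequency queries on $T$ in $O(m|G|^{1-\epsilon}\log^{O(1)}N)$ time.
   Context: **Model and asymptotics.** Running times are in the standard word RAM model with machine words of $\Theta(\log n)$ bits ($n$ the input-size parameter), where standard arithmetic and bitwise operations take $O(1)$ time. $\log^{O(1)}N$ means $(\log N)^c$ for some constant $c$. The conditions $\sigma=\Omega((N/\log N)^{1/2})$ and $m=\Omega(|G|/\log N)$ restrict the inputs the algorithm must handle to those with $\sigma\ge\kappa(N/\log N)^{1/2}$ and $m\ge\kappa|G|/\log N$ for a fixed constant $\kappa>0$. **Orthogonal Vectors (OV).** Input: a set $A\subseteq\{0,1\}^d$ with $|A|=n$. Output: whether there exist $x,y\in A$ with $\langle x,y\rangle=\sum_{i=1}^d x[i]\,y[i]=0$. **Orthogonal Vectors Conjecture:** for every constant $\epsilon>0$ there exists a constant $c\ge1$ such that OV cannot be solved in $O(n^{2-\epsilon})$ time on instances with $d=c\log n$. **Straight-line grammars.** An SLG is a context-free grammar $G=(V,\Sigma,R,S)$ (nonterminals $V$, terminals $\Sigma$, $V\cap\Sigma=\emptyset$, rules $R\subseteq V\times(V\cup\Sigma)^*$, start symbol $S\in V$) such that each $N\in V$ has exactly one rule $(N,\gamma)\in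 R$, whose right-hand side $\gamma$ is denoted $\mathrm{rhs}_G(N)$, and there is an ordering $N_1,\ldots,N_{|V|}$ of $V$ with $\mathrm{rhs}_G(N_i)\in(\{N_{i+1},\ldots,N_{|V|}\}\cup\Sigma)^*$ for all $i$. Hence $G$ generates (represents) exactly one string. The size of $G$ is $|G|=\sum_{N\in V}\max(|\mathrm{rhs}_G(N)|,1)$. **Range mode frequency query.** Strings are indexed from $1$. For $T\in\Sigma^N$ and $b,e\in\{0,\ldots,N\}$, the query asks for $\mathrm{mode\text{ - }freq}_T(b,e)=\max_{c\in\Sigma}|\{i: b<i\le e,\ T[i]=c\}|$. -}

module Defs where

open import Data.Bool using (Bool; if_then_else_; _∧_; _∨_; _xor_)
open import Data.Fin as Fin using (Fin; toℕ)
open import Data.Fin.Permutation using (Permutation′; _⟨$⟩ʳ_)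
open import Data.Integer using (∣_∣)
open import Data.List as List using (List; []; _∷_; _++_; [_]; length; allFin; filter)
open import Data.List.Extrema.Nat using (max)
open import Data.List.Membership.Propositional using () renaming (_∈_ to _∈ˡ_)
open import Data.Nat using (ℕ; zero; suc; _+_; _*_; _∸_; _^_; _⊔_; _≤_; _<_; _≤?_; _<?_; _≟_; _<ᵇ_; _≡ᵇ_)
open import Data.Nat.DivMod using (_/_; _%_)
open import Data.Nat.ListAction using (sum)
open import Data.Nat.Logarithm using (⌊log₂_⌋; ⌈log₂_⌉)
open import Data.Nat.Properties using (m^n≢0)
open import Data.Product using (Σ; ∃-syntax; ∃₂; _×_; _,_)
open import Data.Rational.Unnormalised using (ℚᵘ; 0ℚᵘ; ↥_; ↧ₙ_) renaming (_<_ to _<ℚ_)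
open import Data.Sum using (_⊎_)
open import Data.Vec as Vec using (Vec; lookup)
open import Data.Vec.Membership.Propositional using (_∈_)
open import Data.Vec.Relation.Unary.Unique.Propositional using (Unique)
open import Relation.Binary.Construct.Closure.ReflexiveTransitive using (Star)
open import Relation.Binary.PropositionalEquality using (_≡_; _≢_)
open import Relation.Nullary using (¬_; does)
open import Relation.Nullary.Decidable using (_×-dec_)

-- A machine has word-sized registers, of which a program mentions only
-- finitely many, and a memory of words addressed by words.  Control flow is
-- structured; every primitive step has unit cost.

Reg : Set
Reg = ℕ

data Op : Set where
  add sub mul quo rem and or xor shl shr lt eq : Op

data Cmd : Set where
  skip    : Cmd
  _≔_     : Reg → ℕ → Cmd
  _≔_⟨_⟩_ : Reg → Reg → Op → Reg → Cmd
  load    : Reg → Reg → Cmd              -- load r a    :  r ← mem[a]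
  store   : Reg → Reg → Cmd              -- store a r   :  mem[a] ← r
  _⨾_     : Cmd → Cmd → Cmd
  if≢0    : Reg → Cmd → Cmd → Cmd
  while≢0 : Reg → Cmd → Cmd

infix  6 _≔_ _≔_⟨_⟩_
infixr 5 _⨾_

record State : Set where
  constructor state
  field
    regs : Reg → ℕ
    mem  : ℕ → ℕ

open State public

_[_↦_] : (ℕ → ℕ) → ℕ → ℕ → (ℕ → ℕ)
(f [ i ↦ x ]) j = if does (j ≟ i) then x else f j

fromBool : Bool → ℕ
fromBool b = if b then 1 else 0

-- `bitwise f k a b` combines the k least significant bits of a and b.
bitwise : (Bool → Bool → Bool) → ℕ → ℕ → ℕ → ℕ
bitwise f zero    a b = 0
bitwise f (suc k) a b =
  fromBool (f (a % 2 ≡ᵇ 1) (b % 2 ≡ᵇ 1)) + 2 * bitwise f k (a / 2) (b / 2)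

module WordRAM (w : ℕ) where

  trunc : ℕ → ℕ
  trunc x = _%_ x (2 ^ w) {{m^n≢0 2 w}}

  -- Results are truncated to w bits by `Exec`; division and remainder by
  -- zero give 0.
  ⟦_⟧ : Op → ℕ → ℕ → ℕ
  ⟦ add ⟧ a b       = a + b
  ⟦ sub ⟧ a b       = a + (2 ^ w ∸ b)
  ⟦ mul ⟧ a b       = a * b
  ⟦ quo ⟧ a zero    = 0
  ⟦ quo ⟧ a (suc b) = a / suc b
  ⟦ rem ⟧ a zero    = 0
  ⟦ rem ⟧ a (suc b) = a % suc b
  ⟦ and ⟧ a b       = bitwise _∧_ w a b
  ⟦ or  ⟧ a b       = bitwise _∨_ w a b
  ⟦ xor ⟧ a b       = bitwise _xor_ w a b
  ⟦ shl ⟧ a b       = a * 2 ^ b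
  ⟦ shr ⟧ a b       = _/_ a (2 ^ b) {{m^n≢0 2 b}}
  ⟦ lt  ⟧ a b       = fromBool (a <ᵇ b)
  ⟦ eq  ⟧ a b       = fromBool (a ≡ᵇ b)

  -- `Exec c s s′ t`: started in s, c halts in s′ after exactly t steps.
  data Exec : Cmd → State → State → ℕ → Set where
    skip    : ∀ {s} → Exec skip s s 1
    const   : ∀ {r k ρ μ} →
              Exec (r ≔ k) (state ρ μ) (state (ρ [ r ↦ trunc k ]) μ) 1
    op      : ∀ {r a o b ρ μ} →
              Exec (r ≔ a ⟨ o ⟩ b) (state ρ μ)
                   (state (ρ [ r ↦ trunc (⟦ o ⟧ (ρ a) (ρ b)) ]) μ) 1
    load    : ∀ {r a ρ μ} →
              Exec (load r a) (state ρ μ) (state (ρ [ r ↦ μ (ρ a) ]) μ) 1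
    store   : ∀ {a r ρ μ} →
              Exec (store a r) (state ρ μ) (state ρ (μ [ ρ a ↦ ρ r ])) 1
    seq     : ∀ {c d s s′ s″ t u} → Exec c s s′ t → Exec d s′ s″ u →
              Exec (c ⨾ d) s s″ (t + u)
    if-then : ∀ {r c d s s′ t} → regs s r ≢ 0 → Exec c s s′ t →
              Exec (if≢0 r c d) s s′ (suc t)
    if-else : ∀ {r c d s s′ t} → regs s r ≡ 0 → Exec d s s′ t →
              Exec (if≢0 r c d) s s′ (suc t)
    stop    : ∀ {r c s} → regs s r ≡ 0 → Exec (while≢0 r c) s s 1
    loop    : ∀ {r c s s′ s″ t u} → regs s r ≢ 0 → Exec c s s′ t →
              Exec (while≢0 r c) s′ s″ u →
              Exec (while≢0 r c) s s″ (suc (t + u))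

  cell : List ℕ → ℕ → ℕ
  cell []       _       = 0
  cell (x ∷ xs) zero    = x
  cell (x ∷ xs) (suc a) = cell xs a

  -- The input occupies the memory from address 0; everything else is 0.
  initial : List ℕ → State
  initial xs = state (λ _ → 0) (λ a → trunc (cell xs a))

-- `Correct x μ`: the final memory μ holds a correct output for x.
record Problem : Set₁ where
  field
    Instance : Set
    size     : Instance → ℕ
    encode   : Instance → List ℕ
    Correct  : Instance → (ℕ → ℕ) → Set

bits : ℕ → ℕ
bits n = ⌈log₂ suc n ⌉

-- One program that, for a sufficiently large constant k₀, is correct for all
-- word sizes w = Θ(log size) with w ≥ k₀ · log size.  `Within γ x t` says that
-- running time t on instance x is within the bound whose hidden constants are
-- γ; these may depend on the upper constant K of the word size, but not on the
-- instance.
SolvableWithin : (P : Problem) {Γ : Set} →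
                 (Γ → Problem.Instance P → ℕ → Set) → Set
SolvableWithin P {Γ} Within =
  Σ Cmd λ prog → Σ ℕ λ k₀ → (K : ℕ) → Σ Γ λ γ →
  (x : Instance) (w : ℕ) →
  k₀ * bits (size x) ≤ w → w ≤ K * bits (size x) →
  Σ State λ s → Σ ℕ λ t →
    WordRAM.Exec w prog (WordRAM.initial w (encode x)) s t
    × Correct x (mem s)
    × Within γ x t
  where open Problem P

-- Numerator (in absolute value) and denominator; used for positive q only.
num den : ℚᵘ → ℕ
num q = ∣ ↥ q ∣
den q = ↧ₙ q

⟨_,_⟩ : ∀ {d} → Vec (Fin 2) d → Vec (Fin 2) d → ℕ
⟨ x , y ⟩ = Vec.sum (Vec.zipWith (λ a b → toℕ a * toℕ b) x y)

-- A set of n vectors, listed without repetition, in dimension c log n.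
record OVInstance (c : ℕ) : Set where
  field
    n      : ℕ
    n≥1    : 1 ≤ n
  d : ℕ
  d = c * ⌈log₂ n ⌉
  field
    A      : Vec (Vec (Fin 2) d) n
    unique : Unique A

  HasOrthogonalPair : Set
  HasOrthogonalPair = ∃₂ λ x y → x ∈ A × y ∈ A × ⟨ x , y ⟩ ≡ 0

encodeOV : ∀ {c} → OVInstance c → List ℕ
encodeOV I = n ∷ d ∷ List.concatMap (λ x → List.map toℕ (Vec.toList x)) (Vec.toList A)
  where open OVInstance I

OV : ℕ → Problem
OV c = record
  { Instance = OVInstance c
  ; size     = OVInstance.n
  ; encode   = encodeOV
  ; Correct  = λ I μ → let open OVInstance I in
                 (μ 0 ≡ 1 × HasOrthogonalPair) ⊎ (μ 0 ≡ 0 × ¬ HasOrthogonalPair)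
  }

-- t ≤ C · n^(2-ε) with ε = p/q, in the form t^q · n^p ≤ (C · n²)^q.
OVWithin : ∀ {c} → ℚᵘ → ℕ → OVInstance c → ℕ → Set
OVWithin ε C I t = t ^ den ε * n ^ num ε ≤ (C * n ^ 2) ^ den ε
  where open OVInstance I

OrthogonalVectorsConjecture : Set
OrthogonalVectorsConjecture =
  (ε : ℚᵘ) → 0ℚᵘ <ℚ ε →
  ∃[ c ] 1 ≤ c × ¬ SolvableWithin (OV c) (OVWithin ε)

data Symbol (v σ : ℕ) : Set where
  nonterminal : Fin v → Symbol v σ
  terminal    : Fin σ → Symbol v σ

-- Nonterminals Fin v; the terminal c : Fin σ stands for the letter 1 + c of
-- {1,…,σ}.
record SLG (v σ : ℕ) : Set where
  field
    start   : Fin v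
    rhs     : Fin v → List (Symbol v σ)
    order   : Permutation′ v
    acyclic : ∀ i j → nonterminal (order ⟨$⟩ʳ j) ∈ˡ rhs (order ⟨$⟩ʳ i) → i Fin.< j

module _ {v σ : ℕ} (G : SLG v σ) where
  open SLG G

  data _⇒_ : List (Symbol v σ) → List (Symbol v σ) → Set where
    rewrite-at : ∀ α N β → (α ++ nonterminal N ∷ β) ⇒ (α ++ rhs N ++ β)

  Represents : ∀ {N} → Vec (Fin σ) N → Set
  Represents T =
    Star _⇒_ [ nonterminal start ] (List.map terminal (Vec.toList T))

  grammarSize : ℕ
  grammarSize = sum (List.map (λ N → length (rhs N) ⊔ 1) (allFin v))

-- |{ i : b < i ≤ e, T[i] = c }|; the 1-based position of i : Fin N is 1 + i.
frequency : ∀ {σ N} → Vec (Fin σ) N → ℕ → ℕ → Fin σ → ℕ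
frequency {N = N} T b e c =
  length (filter (λ i → (b <? suc (toℕ i)) ×-dec (suc (toℕ i) ≤? e)
                          ×-dec (lookup T i Fin.≟ c))
                 (allFin N))

modeFreq : ∀ {σ N} → Vec (Fin σ) N → Fin (suc N) → Fin (suc N) → ℕ
modeFreq {σ} T b e = max 0 (List.map (frequency T (toℕ b) (toℕ e)) (allFin σ))

-- With κ = p/q, the condition σ ≥ κ (N / log N)^(1/2) is squared and cleared of
-- denominators; N ≥ 2 makes log N positive.
record RangeModeInstance (κ : ℚᵘ) : Set where
  field
    {v σ N m} : ℕ
    G          : SLG v σ
    T          : Vec (Fin σ) N
    queries    : Vec (Fin (suc N) × Fin (suc N)) m
    represents : Represents G T
    N≥2        : 2 ≤ N
    σ-large    : num κ ^ 2 * N ≤ den κ ^ 2 * (σ ^ 2 * ⌊log₂ N ⌋)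
    m-large    : num κ * grammarSize G ≤ den κ * (m * ⌊log₂ N ⌋)

-- Letters of {1,…,σ} are encoded as themselves, nonterminals as the numbers
-- from σ + 1 on, and every right-hand side is preceded by its length.
encodeSymbol : ∀ {v σ} → Symbol v σ → ℕ
encodeSymbol         (terminal c)    = suc (toℕ c)
encodeSymbol {σ = σ} (nonterminal N) = suc (σ + toℕ N)

encodeSLG : ∀ {v σ} → SLG v σ → List ℕ
encodeSLG {v} {σ} G =
  v ∷ σ ∷ encodeSymbol {σ = σ} (nonterminal start) ∷
  List.concatMap (λ N → length (rhs N) ∷ List.map encodeSymbol (rhs N)) (allFin v)
  where open SLG G

encodeRangeMode : ∀ {κ} → RangeModeInstance κ → List ℕ
encodeRangeMode I =
  encodeSLG G ++
  m ∷ List.concatMap (λ (b , e) → toℕ b ∷ toℕ e ∷ []) (Vec.toList queries)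
  where open RangeModeInstance I

-- The size parameter bounds all of N, σ, |G| and m, so that positions, symbols
-- and query indices fit in a word.  The answer to query j is at address j.
RangeMode : ℚᵘ → Problem
RangeMode κ = record
  { Instance = RangeModeInstance κ
  ; size     = λ I → let open RangeModeInstance I in N + σ + grammarSize G + m
  ; encode   = encodeRangeMode
  ; Correct  = λ I μ → let open RangeModeInstance I in
                 ∀ (j : Fin m) → let (b , e) = lookup queries j in
                   μ (toℕ j) ≡ modeFreq T b e
  }

-- t ≤ C · m · |G|^(1-ε) · (log N)^k with ε = p/q, cleared of fractional powers
-- as in `OVWithin`.
RangeModeWithin : ∀ {κ} → ℚᵘ → ℕ × ℕ → RangeModeInstance κ → ℕ → Set
RangeModeWithin ε (C , k) I t =
  t ^ den ε * grammarSize G ^ num ε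
    ≤ (C * (m * grammarSize G * ⌊log₂ N ⌋ ^ k)) ^ den ε
  where open RangeModeInstance I

{-# OPTIONS --safe #-}

-- Prepend zero coordinates to the vectors, so that all have D = d + 2
-- coordinates and x[0] = 0.  Row s of the string lists, for every vector y,
-- the letter y if y[s] = 0 and the letter n + y otherwise; the block of x
-- concatenates, for i < D, row i if x[i] = 1 and row 0 if x[i] = 0.  In the
-- block of x the letter y occurs D − ⟨x,y⟩ times and, because of i = 0, n + y
-- at most D − 1 times, so the mode frequency is D exactly if some y is
-- orthogonal to x.  The rows are nonterminals and the whole string is one rule
-- over them, hence the grammar has size 2nD, although N = n²D.  Asking the n
-- block queries num κ · 2D times over gives enough queries for the lower bound on m,
-- and unused letters make σ as large as needed.  With D and log N in O(log n),
-- saving |G|^ε beats all logarithmic factors.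
--
-- The OV program is written for the word RAM: it copies the (extended) vectors
-- beyond the end of its output, overwrites the memory with the grammar and the
-- queries, clears the copy and calls the given program, whose registers lie
-- below its own.
module Submission where

open import Defs
open import Data.Product using (Σ; ∃; _×_; _,_; proj₁; proj₂)
open import Data.Rational.Unnormalised using (ℚᵘ; 0ℚᵘ)
open import Relation.Nullary using (¬_)

-- For each `y`, a row contains exactly one of the letters `y` and `n + y`, so `D` is a common
-- ceiling for all frequencies in a block. This is why a single number, the mode frequency, can
-- report whether some vector reaches the ceiling. The zero coordinate serves twice: because every
-- vector is 0 there, replacing row `i` by row 0 multiplies by `x[i]`, and it keeps the letters
-- `n + y` strictly below the ceiling. Two obstacles shape the program. The given program is known
-- to work only from its exact initial state, with zero registers and nothing in memory but the
-- encoding; this forces the clearing of the copy and a lemma on replaying an execution among other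
-- registers. Words are truncated, so every intermediate value must be seen to fit: values are
-- bounded by powers of one quantity `X`, polynomial in `n`, so that a constant factor in the word
-- size is enough.

module _ where

  open import Data.Bool as Bool using (Bool; true; false; if_then_else_; _∧_)
  open import Data.Bool.Properties using (∧-zeroʳ)
  open import Data.Fin as Fin using (Fin; zero; suc; toℕ; fromℕ<)
  import Data.Fin.Permutation as Permutation
  open import Data.Fin.Properties using (toℕ<n; toℕ-fromℕ<; toℕ-injective)
    renaming (_≟_ to _≟F_)
  import Data.Integer as ℤ
  open import Data.List as List
    using (List; []; _∷_; _++_; length; applyUpTo; concatMap; filter; allFin)
  open import Data.List.Extrema.Nat using (max≤v⁺; v≤max⁺; argmax-sel)
  open import Data.List.Membership.Propositional using () renaming (_∈_ to _∈ˡ_)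
  open import Data.List.Membership.Propositional.Properties
    using (∈-map⁻; ∈-map⁺; ∈-allFin; ∈-concatMap⁻)
  open import Data.List.Properties
    using (length-++; length-map; length-applyUpTo; ++-assoc; ++-identityʳ;
           map-applyUpTo; map-tabulate; tabulate-cong)
  open import Data.List.Relation.Binary.Pointwise using (Pointwise; []; _∷_)
  import Data.List.Relation.Unary.All as ListAll
  open import Data.List.Relation.Unary.All.Properties using () renaming (map⁺ to All-map⁺)
  open import Data.List.Relation.Unary.Any as Any using (here; there; satisfied)
  open import Data.Nat
  open import Data.Nat.DivMod
    using (m%n≤m; m%n<n; m/n≤m; m/n*n≤m; m<n⇒m%n≡m; m<n⇒m/n≡0; m<n*o⇒m/o<n;
           m≡m%n+[m/n]*n; m/n≡1+[m∸n]/n; [m+n]%n≡m%n)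
    renaming (_mod_ to _modF_)
  open import Data.Nat.Induction using (<-rec)
  open import Data.Nat.ListAction using (sum)
  open import Data.Nat.Logarithm
  open import Data.Nat.Properties
  open import Data.Nat.Tactic.RingSolver using (solve-∀)
  open import Data.Rational.Unnormalised as ℚ using (mkℚᵘ; *<*; positive)
  open import Data.Sum using (_⊎_; inj₁; inj₂)
  open import Data.Unit using (⊤; tt)
  open import Data.Vec as Vec using (Vec; []; _∷_; lookup; _[_]≔_)
  open import Data.Vec.Membership.Propositional using (_∈_)
  open import Data.Vec.Membership.Propositional.Properties using (∈-lookup)
  open import Data.Vec.Properties
    using (lookup∘update; lookup∘update′; lookup∘tabulate; length-toList)
  open import Data.Vec.Relation.Unary.All using (All; []; _∷_)
  open import Data.Vec.Relation.Unary.All.Properties using (lookup⁺)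
  open import Data.Vec.Relation.Unary.Any using (here; there)
  open import Function using (_∘_; id)
  open import Relation.Binary.Construct.Closure.ReflexiveTransitive using (Star; _◅_)
  open import Relation.Binary.PropositionalEquality
  open import Relation.Nullary using (yes; no; does; contradiction)
  open import Relation.Nullary.Decidable using (dec-true; dec-false)
  open import Relation.Unary using (Pred; Decidable)

  -- Replaying an execution in a larger machine state

  Mem : Set
  Mem = ℕ → ℕ

  update-at : ∀ (f : ℕ → ℕ) i x {j} → j ≡ i → (f [ i ↦ x ]) j ≡ x
  update-at f i x {j} j≡i = cong (if_then x else f j) (dec-true (j ≟ i) j≡i)

  update-other : ∀ (f : ℕ → ℕ) i x {j} → j ≢ i → (f [ i ↦ x ]) j ≡ f j
  update-other f i x {j} j≢i = cong (if_then x else f j) (dec-false (j ≟ i) j≢i)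

  update-cong : ∀ (f g : ℕ → ℕ) {i i′ x x′} j → i ≡ i′ → x ≡ x′ → f j ≡ g j →
                (f [ i ↦ x ]) j ≡ (g [ i′ ↦ x′ ]) j
  update-cong f g {i} {x = x} j refl refl e = cong (if does (j ≟ i) then x else_) e

  registerBound : Cmd → ℕ
  registerBound skip            = 0
  registerBound (r ≔ k)         = suc r
  registerBound (r ≔ a ⟨ o ⟩ b) = suc r ⊔ (suc a ⊔ suc b)
  registerBound (load r a)      = suc r ⊔ suc a
  registerBound (store a r)     = suc a ⊔ suc r
  registerBound (c ⨾ d)         = registerBound c ⊔ registerBound d
  registerBound (if≢0 r c d)    = suc r ⊔ (registerBound c ⊔ registerBound d)
  registerBound (while≢0 r c)   = suc r ⊔ registerBound c

  module _ {w : ℕ} where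
    open WordRAM w

    private
      Transported : ℕ → Cmd → State → ℕ → (Reg → ℕ) → Mem → Set
      Transported R c s t ρ μ =
        Σ (Reg → ℕ) λ ρ′ → Σ Mem λ μ′ →
        Exec c (state ρ μ) (state ρ′ μ′) t
        × (∀ {r} → r < R → regs s r ≡ ρ′ r) × (∀ a → mem s a ≡ μ′ a)
        × (∀ {r} → R ≤ r → ρ′ r ≡ ρ r)

    -- A command neither reads nor writes registers from its bound on, so its execution can be
    -- replayed step by step while the caller keeps variables there. Agreement is pointwise because
    -- the memory prepared by the reduction is compared with the initial one cell by cell.
    transport : ∀ {R c s s′ t} → Exec c s s′ t → registerBound c ≤ R →
                ∀ ρ μ → (∀ {r} → r < R → regs s r ≡ ρ r) → (∀ a → mem s a ≡ μ a) →
                Transported R c s′ t ρ μ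
    transport skip _ ρ μ lo me = ρ , μ , skip , lo , me , λ _ → refl
    transport (const {ρ = ρ₁}) b ρ μ lo me =
      _ , μ , const , (λ r< → update-cong ρ₁ ρ _ refl refl (lo r<)) , me ,
      λ R≤ → update-other ρ _ _ (>⇒≢ (≤-trans b R≤))
    transport {R} (op {r} {a} {o} {b′} {ρ₁}) b ρ μ lo me =
      _ , μ , op ,
      (λ r< → update-cong ρ₁ ρ _ refl
        (cong₂ (λ x y → trunc (⟦ o ⟧ x y))
          (lo (m⊔n≤o⇒m≤o (suc a) (suc b′) ab))
          (lo (m⊔n≤o⇒n≤o (suc a) (suc b′) ab))) (lo r<)) ,
      me , λ R≤ → update-other ρ _ _ (>⇒≢ (≤-trans (m⊔n≤o⇒m≤o (suc r) (suc (a ⊔ b′)) b) R≤))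
      where ab = m⊔n≤o⇒n≤o (suc r) (suc (a ⊔ b′)) b
    transport (load {r} {a} {ρ = ρ₁} {μ = μ₁}) b ρ μ lo me =
      _ , μ , load ,
      (λ r< → update-cong ρ₁ ρ _ refl
        (trans (cong μ₁ (lo (m⊔n≤o⇒n≤o (suc r) (suc a) b))) (me _)) (lo r<)) ,
      me , λ R≤ → update-other ρ _ _ (>⇒≢ (≤-trans (m⊔n≤o⇒m≤o (suc r) (suc a) b) R≤))
    transport (store {a} {r} {μ = μ₁}) b ρ μ lo me =
      ρ , _ , store , lo ,
      (λ i → update-cong μ₁ μ i (lo (m⊔n≤o⇒m≤o (suc a) (suc r) b))
                                (lo (m⊔n≤o⇒n≤o (suc a) (suc r) b)) (me i)) ,
      λ _ → refl
    transport (seq {c} {d} x y) b ρ μ lo me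
      with transport x (m⊔n≤o⇒m≤o (registerBound c) _ b) ρ μ lo me
    ... | ρ₁ , μ₁ , x₁ , lo₁ , me₁ , hi₁
      with transport y (m⊔n≤o⇒n≤o (registerBound c) _ b) ρ₁ μ₁ lo₁ me₁
    ... | ρ₂ , μ₂ , x₂ , lo₂ , me₂ , hi₂ =
      ρ₂ , μ₂ , seq x₁ x₂ , lo₂ , me₂ , λ R≤ → trans (hi₂ R≤) (hi₁ R≤)
    transport (if-then {r} {c} {d} r≢0 x) b ρ μ lo me
      with cd ← registerBound c ⊔ registerBound d in e
      with transport x (m⊔n≤o⇒m≤o (registerBound c) (registerBound d)
             (≤-trans (≤-reflexive e) (m⊔n≤o⇒n≤o (suc r) cd b))) ρ μ lo me
    ... | ρ₁ , μ₁ , x₁ , rest =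
      ρ₁ , μ₁ , if-then (λ r≡0 → r≢0 (trans (lo (m⊔n≤o⇒m≤o (suc r) cd b)) r≡0)) x₁ , rest
    transport (if-else {r} {c} {d} r≡0 x) b ρ μ lo me
      with cd ← registerBound c ⊔ registerBound d in e
      with transport x (m⊔n≤o⇒n≤o (registerBound c) (registerBound d)
             (≤-trans (≤-reflexive e) (m⊔n≤o⇒n≤o (suc r) cd b))) ρ μ lo me
    ... | ρ₁ , μ₁ , x₁ , rest =
      ρ₁ , μ₁ , if-else (trans (sym (lo (m⊔n≤o⇒m≤o (suc r) cd b))) r≡0) x₁ , rest
    transport (stop {r} {c} r≡0) b ρ μ lo me =
      ρ , μ , stop (trans (sym (lo (m⊔n≤o⇒m≤o (suc r) (registerBound c) b))) r≡0) ,
      lo , me , λ _ → refl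
    transport (loop {r} {c} r≢0 x y) b ρ μ lo me
      with transport x (m⊔n≤o⇒n≤o (suc r) (registerBound c) b) ρ μ lo me
    ... | ρ₁ , μ₁ , x₁ , lo₁ , me₁ , hi₁
      with transport y b ρ₁ μ₁ lo₁ me₁
    ... | ρ₂ , μ₂ , x₂ , lo₂ , me₂ , hi₂ =
      ρ₂ , μ₂ ,
      loop (λ r≡0 → r≢0 (trans (lo (m⊔n≤o⇒m≤o (suc r) (registerBound c) b)) r≡0)) x₁ x₂ ,
      lo₂ , me₂ , λ R≤ → trans (hi₂ R≤) (hi₁ R≤)

  -- Compiling arithmetic and counted loops

  Var : Set
  Var = Fin 6

  Env : Set
  Env = Vec ℕ 6

  -- These are operations that mean the same on ℕ and on words before truncation, and whose result
  -- is at most the product of bounds on the operands once these bounds are at least 2. Subtraction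
  -- is left out because it wraps around modulo `2 ^ w`.
  data Arith : Set where
    plus times over modulo less equal : Arith

  data Expr : Set where
    lit : ℕ → Expr
    var : Var → Expr
    op  : Arith → Expr → Expr → Expr
    ld  : Expr → Expr

  infixl 6 _⊕_
  infixl 7 _⊗_ _⊘_ _⊙_
  infix  5 _⊲_ _≐_
  pattern _⊕_ a b = op plus a b
  pattern _⊗_ a b = op times a b
  pattern _⊘_ a b = op over a b
  pattern _⊙_ a b = op modulo a b
  pattern _⊲_ a b = op less a b
  pattern _≐_ a b = op equal a b

  infixl 7 _div_ _mod_
  _div_ _mod_ : ℕ → ℕ → ℕ
  a div zero  = 0
  a div suc b = a / suc b
  a mod zero  = 0
  a mod suc b = a % suc b

  arith : Arith → ℕ → ℕ → ℕ
  arith plus   a b = a + b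
  arith times  a b = a * b
  arith over   a b = a div b
  arith modulo a b = a mod b
  arith less   a b = fromBool (a <ᵇ b)
  arith equal  a b = fromBool (a ≡ᵇ b)

  opcode : Arith → Op
  opcode plus   = add
  opcode times  = mul
  opcode over   = quo
  opcode modulo = rem
  opcode less   = lt
  opcode equal  = eq

  opcode-correct : ∀ w o a b → WordRAM.⟦_⟧ w (opcode o) a b ≡ arith o a b
  opcode-correct w plus   a b       = refl
  opcode-correct w times  a b       = refl
  opcode-correct w over   a zero    = refl
  opcode-correct w over   a (suc b) = refl
  opcode-correct w modulo a zero    = refl
  opcode-correct w modulo a (suc b) = refl
  opcode-correct w less   a b       = refl
  opcode-correct w equal  a b       = refl

  eval : Env → Mem → Expr → ℕ
  eval η μ (lit k)    = k
  eval η μ (var x)    = lookup η x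
  eval η μ (op o a b) = arith o (eval η μ a) (eval η μ b)
  eval η μ (ld a)     = μ (eval η μ a)

  -- An exponent: values will be bounded by `X ^ size e`. A literal weighs `suc k` since
  -- `k ≤ 2 ^ k ≤ X ^ k`. A load weighs more than its address, so that a bound on the whole
  -- expression also covers the address.
  size : Expr → ℕ
  size (lit k)    = suc k
  size (var x)    = 1
  size (op o a b) = size a + size b
  size (ld a)     = suc (size a)

  -- A variable costs two steps because registers are copied by adding to a zeroed register. The
  -- sums are bracketed as `seq` adds running times.
  cost : Expr → ℕ
  cost (lit k)    = 1
  cost (var x)    = 2
  cost (op o a b) = cost a + (cost b + 1)
  cost (ld a)     = cost a + 1

  1≤size : ∀ e → 1 ≤ size e
  1≤size (lit k)    = s≤s z≤n
  1≤size (var x)    = s≤s z≤n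
  1≤size (op o a b) = ≤-trans (1≤size a) (m≤m+n _ _)
  1≤size (ld a)     = s≤s z≤n

  fromBool≤1 : ∀ b → fromBool b ≤ 1
  fromBool≤1 false = z≤n
  fromBool≤1 true  = s≤s z≤n

  -- Equivalent to `(a − 1)(b − 1) ≥ 1`. It lets sums and products share one bound.
  sum≤product : ∀ {a b} → 2 ≤ a → 2 ≤ b → a + b ≤ a * b
  sum≤product {suc a} {suc b} (s≤s 1≤a) (s≤s 1≤b) = begin
    suc a + suc b         ≡⟨ +-comm (suc a) (suc b) ⟩
    suc b + suc a         ≤⟨ +-monoʳ-≤ (suc b) (≤-trans (+-monoˡ-≤ a 1≤a) (≤-reflexive (lem a))) ⟩
    suc b + a * 2         ≤⟨ +-monoʳ-≤ (suc b) (*-monoʳ-≤ a (s≤s 1≤b)) ⟩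
    suc a * suc b         ∎
    where
    open ≤-Reasoning
    lem : ∀ a → a + a ≡ a * 2
    lem a = trans (cong (a +_) (sym (+-identityʳ a))) (*-comm 2 a)

  arith≤ : ∀ o {a b p q} → 2 ≤ p → 2 ≤ q → a ≤ p → b ≤ q → arith o a b ≤ p * q
  arith≤ plus   2≤p 2≤q a≤ b≤ = ≤-trans (+-mono-≤ a≤ b≤) (sum≤product 2≤p 2≤q)
  arith≤ times  2≤p 2≤q a≤ b≤ = *-mono-≤ a≤ b≤
  arith≤ over   {a} {zero}  2≤p 2≤q a≤ b≤ = z≤n
  arith≤ over   {a} {suc b} {p} {q} 2≤p 2≤q a≤ b≤ =
    ≤-trans (m/n≤m a (suc b)) (≤-trans a≤ (m≤m*n p q {{>-nonZero (≤-trans (s≤s z≤n) 2≤q)}}))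
  arith≤ modulo {a} {zero}  2≤p 2≤q a≤ b≤ = z≤n
  arith≤ modulo {a} {suc b} {p} {q} 2≤p 2≤q a≤ b≤ =
    ≤-trans (m%n≤m a (suc b)) (≤-trans a≤ (m≤m*n p q {{>-nonZero (≤-trans (s≤s z≤n) 2≤q)}}))
  arith≤ less   2≤p 2≤q a≤ b≤ =
    ≤-trans (fromBool≤1 _) (*-mono-≤ (≤-trans (s≤s z≤n) 2≤p) (≤-trans (s≤s z≤n) 2≤q))
  arith≤ equal  2≤p 2≤q a≤ b≤ =
    ≤-trans (fromBool≤1 _) (*-mono-≤ (≤-trans (s≤s z≤n) 2≤p) (≤-trans (s≤s z≤n) 2≤q))

  n≤2^n : ∀ n → n ≤ 2 ^ n
  n≤2^n zero    = z≤n
  n≤2^n (suc n) = begin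
    suc n           ≤⟨ +-mono-≤ (m^n>0 2 n) (n≤2^n n) ⟩
    2 ^ n + 2 ^ n   ≡⟨ cong (2 ^ n +_) (+-identityʳ _) ⟨
    2 ^ suc n       ∎
    where open ≤-Reasoning

  -- The side condition of evaluation: a loaded word is bounded by hypothesis, since its size cannot
  -- be read off the expression.
  Reads : ℕ → Env → Mem → Expr → Set
  Reads X η μ (lit k)    = ⊤
  Reads X η μ (var x)    = ⊤
  Reads X η μ (op o a b) = Reads X η μ a × Reads X η μ b
  Reads X η μ (ld a)     = Reads X η μ a × μ (eval η μ a) ≤ X

  module _ {X : ℕ} (2≤X : 2 ≤ X) where

    private
      instance
        X≢0 : NonZero X
        X≢0 = >-nonZero (≤-trans (s≤s z≤n) 2≤X)

    X≤X^ : ∀ {k} → 1 ≤ k → X ≤ X ^ k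
    X≤X^ {k} 1≤k = ≤-trans (≤-reflexive (sym (^-identityʳ X))) (^-monoʳ-≤ X 1≤k)

    eval≤ : ∀ {η μ} e → All (_≤ X) η → Reads X η μ e → eval η μ e ≤ X ^ size e
    eval≤ (lit k) η≤ r =
      ≤-trans (≤-trans (n≤2^n k) (^-monoˡ-≤ k 2≤X)) (^-monoʳ-≤ X (n≤1+n k))
    eval≤ (var x) η≤ r = ≤-trans (lookup⁺ η≤ x) (X≤X^ ≤-refl)

    eval≤ {η} {μ} (op o a b) η≤ (ra , rb) = begin
      arith o (eval η μ a) (eval η μ b)
        ≤⟨ arith≤ o (≤-trans 2≤X (X≤X^ (1≤size a))) (≤-trans 2≤X (X≤X^ (1≤size b)))
                    (eval≤ a η≤ ra) (eval≤ b η≤ rb) ⟩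
      X ^ size a * X ^ size b           ≡⟨ ^-distribˡ-+-* X (size a) (size b) ⟨
      X ^ (size a + size b)             ∎
      where open ≤-Reasoning
    eval≤ (ld a) η≤ (ra , r≤) = ≤-trans r≤ (X≤X^ {suc (size a)} (s≤s z≤n))

  -- n, d, num κ, then loop counter, loop condition and accumulator.
  pattern nᵛ = zero
  pattern dᵛ = suc zero
  pattern cᵛ = suc (suc zero)
  pattern jᵛ = suc (suc (suc zero))
  pattern fᵛ = suc (suc (suc (suc zero)))
  pattern aᵛ = suc (suc (suc (suc (suc zero))))

  -- Blocks of memory cells and of list entries

  -- The last write is outermost, so one more pass of a filling loop is definitionally one more
  -- update.
  writes : Mem → ℕ → (ℕ → ℕ) → ℕ → Mem
  writes μ p f zero    = μ
  writes μ p f (suc k) = writes μ p f k [ p + k ↦ f k ]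

  writes-below : ∀ μ p f k {i} → i < p → writes μ p f k i ≡ μ i
  writes-below μ p f zero    i<p = refl
  writes-below μ p f (suc k) i<p =
    trans (update-other (writes μ p f k) _ _ (<⇒≢ (<-≤-trans i<p (m≤m+n p k)))) (writes-below μ p f k i<p)

  writes-above : ∀ μ p f k {i} → p + k ≤ i → writes μ p f k i ≡ μ i
  writes-above μ p f zero    ≤i = refl
  writes-above μ p f (suc k) ≤i =
    trans (update-other (writes μ p f k) _ _ (>⇒≢ p+k<i)) (writes-above μ p f k (<⇒≤ p+k<i))
    where p+k<i = ≤-trans (≤-reflexive (sym (+-suc p k))) ≤i

  writes-inside : ∀ μ p f {k i} → i < k → writes μ p f k (p + i) ≡ f i
  writes-inside μ p f {suc k} {i} i<1+k with i ≟ k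
  ... | yes refl = update-at (writes μ p f k) (p + k) _ refl
  ... | no i≢k   =
    trans (update-other (writes μ p f k) _ _ (i≢k ∘ +-cancelˡ-≡ p i k))
      (writes-inside μ p f (≤∧≢⇒< (s≤s⁻¹ i<1+k) i≢k))

  -- A copy of `cell` outside the module over `w`, so that facts about encodings do not mention the
  -- word size.
  at : List ℕ → ℕ → ℕ
  at []       _       = 0
  at (x ∷ xs) zero    = x
  at (x ∷ xs) (suc i) = at xs i

  cell≡at : ∀ w xs i → WordRAM.cell w xs i ≡ at xs i
  cell≡at w []       i       = refl
  cell≡at w (x ∷ xs) zero    = refl
  cell≡at w (x ∷ xs) (suc i) = cell≡at w xs i

  at-++ˡ : ∀ xs {ys i} → i < length xs → at (xs ++ ys) i ≡ at xs i
  at-++ˡ (x ∷ xs) {i = zero}  i< = refl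
  at-++ˡ (x ∷ xs) {i = suc i} i< = at-++ˡ xs (s≤s⁻¹ i<)

  at-++ʳ : ∀ xs {ys} i → at (xs ++ ys) (length xs + i) ≡ at ys i
  at-++ʳ []       i = refl
  at-++ʳ (x ∷ xs) i = at-++ʳ xs i

  at-beyond : ∀ xs {i} → length xs ≤ i → at xs i ≡ 0
  at-beyond []       _           = refl
  at-beyond (x ∷ xs) (s≤s len≤i) = at-beyond xs len≤i

  at-applyUpTo : ∀ f {k i} → i < k → at (applyUpTo f k) i ≡ f i
  at-applyUpTo f {suc k} {zero}  i< = refl
  at-applyUpTo f {suc k} {suc i} i< = at-applyUpTo (f ∘ suc) (s≤s⁻¹ i<)

  -- An encoding seen as consecutive blocks, each given by a length and an entry function; the
  -- output program has one loop per block.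
  segments : List (ℕ × (ℕ → ℕ)) → List ℕ
  segments []             = []
  segments ((L , f) ∷ ls) = applyUpTo f L ++ segments ls

  length-segments-∷ : ∀ p L f ls →
    p + length (segments ((L , f) ∷ ls)) ≡ p + L + length (segments ls)
  length-segments-∷ p L f ls = trans (cong (p +_) (trans (length-++ (applyUpTo f L))
    (cong (_+ length (segments ls)) (length-applyUpTo f L)))) (sym (+-assoc p L _))

  module Compiler (R : ℕ) where

    reg : Var → Reg
    reg x = R + toℕ x

    tmp : ℕ → Reg
    tmp k = R + (6 + k)

    compile : Expr → ℕ → Cmd
    compile (lit m)    k = tmp k ≔ m
    compile (var x)    k = (tmp k ≔ 0) ⨾ (tmp k ≔ reg x ⟨ add ⟩ tmp k)
    compile (op o a b) k = compile a k ⨾ compile b (suc k) ⨾ (tmp k ≔ tmp k ⟨ opcode o ⟩ tmp (suc k))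
    compile (ld a)     k = compile a k ⨾ load (tmp k) (tmp k)

    assign : Var → Expr → Cmd
    assign x e = compile e 0 ⨾ (tmp 1 ≔ 0) ⨾ (reg x ≔ tmp 0 ⟨ add ⟩ tmp 1)

    put : Expr → Expr → Cmd
    put a e = compile a 0 ⨾ compile e 1 ⨾ store (tmp 0) (tmp 1)

    for : Expr → Cmd → Cmd
    for c body =
      assign jᵛ (lit 0) ⨾ assign fᵛ (var jᵛ ⊲ c) ⨾
      while≢0 (reg fᵛ) (body ⨾ assign jᵛ (var jᵛ ⊕ lit 1) ⨾ assign fᵛ (var jᵛ ⊲ c))

    fill : Expr → Expr → Expr → Cmd
    fill base c e = for c (put (base ⊕ var jᵛ) e)

    -- No pointer is kept between blocks: the start of the next block is the expression `base ⊕ c`,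
    -- evaluated anew for every write.
    emit : Expr → List (Expr × Expr) → Cmd
    emit base []             = skip
    emit base ((c , e) ∷ ss) = fill base c e ⨾ emit (base ⊕ c) ss

    assignCost : Expr → ℕ
    assignCost e = cost e + 2

    putCost : Expr → Expr → ℕ
    putCost a e = cost a + (cost e + 1)

    loopCost : ℕ → ℕ → ℕ
    loopCost b zero    = 1
    loopCost b (suc k) = suc (b + loopCost b k)

    forCost : Expr → ℕ → ℕ → ℕ
    forCost c b k =
      assignCost (lit 0) + (assignCost (var jᵛ ⊲ c) +
        loopCost (b + (assignCost (var jᵛ ⊕ lit 1) + assignCost (var jᵛ ⊲ c))) k)

    -- The summand 2 pays for the test before each pass and for the final failing test, when both
    -- the number of passes and 1 are at most `U`.
    forBound : Expr → ℕ → ℕ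
    forBound c b =
      assignCost (lit 0) + (assignCost (var jᵛ ⊲ c) +
        (2 + (b + (assignCost (var jᵛ ⊕ lit 1) + assignCost (var jᵛ ⊲ c)))))

    emitBound : Expr → List (Expr × Expr) → ℕ
    emitBound base []             = 1
    emitBound base ((c , e) ∷ ss) =
      forBound c (putCost (base ⊕ var jᵛ) e) + emitBound (base ⊕ c) ss

    Sized : Expr → List (Expr × Expr) → Set
    Sized base []             = ⊤
    Sized base ((c , e) ∷ ss) =
      size base + 1 ≤ 200 × suc (size c) ≤ 200 × size e ≤ 200 × Sized (base ⊕ c) ss

    loopCost≤ : ∀ b {k U} → 1 ≤ U → k ≤ U → loopCost b k ≤ (2 + b) * U
    loopCost≤ b {k} {U} 1≤U k≤U = begin
      loopCost b k         ≡⟨ lem k ⟩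
      1 + k * suc b        ≤⟨ +-mono-≤ 1≤U (*-monoˡ-≤ (suc b) k≤U) ⟩
      U + U * suc b        ≡⟨ cong (U +_) (*-comm U (suc b)) ⟩
      (2 + b) * U          ∎
      where
      open ≤-Reasoning
      lem : ∀ k → loopCost b k ≡ 1 + k * suc b
      lem zero    = refl
      lem (suc k) = cong suc (trans (cong (b +_) (lem k)) (+-suc b _))

    forCost≤ : ∀ c b {k U} → 1 ≤ U → k ≤ U → forCost c b k ≤ forBound c b * U
    forCost≤ c b {k} {U} 1≤U k≤U = begin
      x + (y + loopCost z k)       ≤⟨ +-mono-≤ (up x) (+-mono-≤ (up y) (loopCost≤ z 1≤U k≤U)) ⟩
      x * U + (y * U + (2 + z) * U) ≡⟨ cong (x * U +_) (*-distribʳ-+ U y (2 + z)) ⟨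
      x * U + (y + (2 + z)) * U    ≡⟨ *-distribʳ-+ U x (y + (2 + z)) ⟨
      (x + (y + (2 + z))) * U      ∎
      where
      open ≤-Reasoning
      x = assignCost (lit 0)
      y = assignCost (var jᵛ ⊲ c)
      z = b + (assignCost (var jᵛ ⊕ lit 1) + assignCost (var jᵛ ⊲ c))
      up : ∀ m → m ≤ m * U
      up m = m≤m*n m U {{>-nonZero 1≤U}}

    reg<tmp : ∀ x k → reg x < tmp k
    reg<tmp x k = +-monoʳ-< R (≤-trans (toℕ<n x) (m≤m+n 6 k))

    tmp<tmp : ∀ {k l} → k < l → tmp k < tmp l
    tmp<tmp k<l = +-monoʳ-< R (+-monoʳ-< 6 k<l)

    R≤reg : ∀ x → R ≤ reg x
    R≤reg x = m≤m+n R (toℕ x)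

    R≤tmp : ∀ k → R ≤ tmp k
    R≤tmp k = m≤m+n R (6 + k)

    reg-injective : ∀ {x y} → reg x ≡ reg y → x ≡ y
    reg-injective e = toℕ-injective (+-cancelˡ-≡ R _ _ e)

    -- An expression of size s has value at most X ^ s, and every expression of
    -- the program has size at most 200, so nothing overflows.
    module Semantics {w X} (2≤X : 2 ≤ X) (X^200<2^w : X ^ 200 < 2 ^ w) where
      open WordRAM w

      private
        instance
          2^w≢0 : NonZero (2 ^ w)
          2^w≢0 = m^n≢0 2 w
          X≢0 : NonZero X
          X≢0 = >-nonZero (≤-trans (s≤s z≤n) 2≤X)

      trunc-id : ∀ {x} → x < 2 ^ w → trunc x ≡ x
      trunc-id x< = m<n⇒m%n≡m x<

      trunc0 : trunc 0 ≡ 0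
      trunc0 = trunc-id (m^n>0 2 w)

      fits : ∀ {x} → x ≤ X → x < 2 ^ w
      fits x≤X = ≤-<-trans (≤-trans x≤X (X≤X^ 2≤X {200} (s≤s z≤n))) X^200<2^w

      eval< : ∀ {η μ} e → All (_≤ X) η → Reads X η μ e → size e ≤ 200 → eval η μ e < 2 ^ w
      eval< e η≤ r s≤ = ≤-<-trans (≤-trans (eval≤ 2≤X e η≤ r) (^-monoʳ-≤ X s≤)) X^200<2^w

      Agree : Env → (Reg → ℕ) → Set
      Agree η ρ = ∀ x → ρ (reg x) ≡ lookup η x

      -- The last component is what makes the induction work: evaluation at depth `k` touches no
      -- register below `tmp k`, so a left operand survives the evaluation of the right one.
      compile-correct : ∀ e k {η μ ρ} → Agree η ρ → All (_≤ X) η → Reads X η μ e → size e ≤ 200 →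
        Σ (Reg → ℕ) λ ρ′ → Exec (compile e k) (state ρ μ) (state ρ′ μ) (cost e)
          × ρ′ (tmp k) ≡ eval η μ e × (∀ {r} → r < tmp k → ρ′ r ≡ ρ r)
      compile-correct (lit m) k {η} {μ} {ρ} ag η≤ rd sz =
        _ , const , trans (update-at ρ (tmp k) _ refl) (trunc-id (eval< {η} {μ} (lit m) η≤ rd sz)) ,
        λ r< → update-other ρ _ _ (<⇒≢ r<)
      compile-correct (var x) k {η} {μ} {ρ} ag η≤ rd sz =
        _ , seq const op ,
        (begin
          (ρ₁ [ tmp k ↦ trunc (ρ₁ (reg x) + ρ₁ (tmp k)) ]) (tmp k)
            ≡⟨ update-at ρ₁ (tmp k) _ refl ⟩
          trunc (ρ₁ (reg x) + ρ₁ (tmp k))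
            ≡⟨ cong₂ (λ p q → trunc (p + q))
                 (trans (update-other ρ _ _ (<⇒≢ (reg<tmp x k))) (ag x))
                 (trans (update-at ρ (tmp k) _ refl) trunc0) ⟩
          trunc (lookup η x + 0)  ≡⟨ cong trunc (+-identityʳ _) ⟩
          trunc (lookup η x)      ≡⟨ trunc-id (eval< {η} {μ} (var x) η≤ rd sz) ⟩
          lookup η x              ∎) ,
        λ r< → trans (update-other ρ₁ _ _ (<⇒≢ r<)) (update-other ρ _ _ (<⇒≢ r<))
        where
        open ≡-Reasoning
        ρ₁ = ρ [ tmp k ↦ trunc 0 ]
      compile-correct (op o a b) k {η} {μ} {ρ} ag η≤ (ra , rb) sz
        with compile-correct a k ag η≤ ra (≤-trans (m≤m+n _ _) sz)
      ... | ρ₁ , x₁ , v₁ , k₁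
        with compile-correct b (suc k) {ρ = ρ₁} (λ x → trans (k₁ (reg<tmp x k)) (ag x)) η≤ rb
               (≤-trans (m≤n+m _ (size a)) sz)
      ... | ρ₂ , x₂ , v₂ , k₂ =
        _ , seq x₁ (seq x₂ op) ,
        (begin
          (ρ₂ [ tmp k ↦ trunc v ]) (tmp k)      ≡⟨ update-at ρ₂ (tmp k) _ refl ⟩
          trunc (⟦ opcode o ⟧ (ρ₂ (tmp k)) (ρ₂ (tmp (suc k))))
            ≡⟨ cong trunc (opcode-correct w o _ _) ⟩
          trunc (arith o (ρ₂ (tmp k)) (ρ₂ (tmp (suc k))))
            ≡⟨ cong₂ (λ p q → trunc (arith o p q))
                     (trans (k₂ (tmp<tmp (n<1+n k))) v₁) v₂ ⟩
          trunc (eval η μ (op o a b))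
            ≡⟨ trunc-id (eval< {η} {μ} (op o a b) η≤ (ra , rb) sz) ⟩
          eval η μ (op o a b)  ∎) ,
        λ r< → trans (update-other ρ₂ _ _ (<⇒≢ r<))
                 (trans (k₂ (<-trans r< (tmp<tmp (n<1+n k)))) (k₁ r<))
        where
        open ≡-Reasoning
        v = ⟦ opcode o ⟧ (ρ₂ (tmp k)) (ρ₂ (tmp (suc k)))
      compile-correct (ld a) k {η} {μ} {ρ} ag η≤ (ra , _) sz
        with compile-correct a k ag η≤ ra (≤-trans (n≤1+n _) sz)
      ... | ρ₁ , x₁ , v₁ , k₁ =
        _ , seq x₁ load , trans (update-at ρ₁ (tmp k) _ refl) (cong μ v₁) ,
        λ r< → trans (update-other ρ₁ _ _ (<⇒≢ r<)) (k₁ r<)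

      -- Quantified over all register files that agree with the environment, because the temporaries
      -- hold leftovers of earlier evaluations. Registers below `R` are reserved for the given
      -- program.
      record Run (c : Cmd) (η : Env) (μ : Mem) (η′ : Env) (μ′ : Mem) (t : ℕ) : Set where
        field
          run : ∀ ρ → Agree η ρ → Σ (Reg → ℕ) λ ρ′ →
            Exec c (state ρ μ) (state ρ′ μ′) t × Agree η′ ρ′ × (∀ {r} → r < R → ρ′ r ≡ ρ r)

      open Run public

      infixr 5 _⟫_
      _⟫_ : ∀ {c d η μ η₁ μ₁ η₂ μ₂ t u} →
            Run c η μ η₁ μ₁ t → Run d η₁ μ₁ η₂ μ₂ u → Run (c ⨾ d) η μ η₂ μ₂ (t + u)
      (p ⟫ q) .run ρ ag with p .run ρ ag
      ... | ρ₁ , x₁ , ag₁ , lo₁ with q .run ρ₁ ag₁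
      ... | ρ₂ , x₂ , ag₂ , lo₂ = ρ₂ , seq x₁ x₂ , ag₂ , λ r< → trans (lo₂ r<) (lo₁ r<)

      run-assign : ∀ x e {η μ} → All (_≤ X) η → Reads X η μ e → size e ≤ 200 →
                   Run (assign x e) η μ (η [ x ]≔ eval η μ e) μ (cost e + 2)
      run-assign x e {η} {μ} η≤ rd sz .run ρ ag with compile-correct e 0 ag η≤ rd sz
      ... | ρ₁ , x₁ , v₁ , k₁ =
        ρ₃ , seq x₁ (seq const op) , agree ,
        λ r< → trans (update-other ρ₂ _ _ (<⇒≢ (<-≤-trans r< (R≤reg x))))
                 (trans (update-other ρ₁ _ _ (<⇒≢ (<-≤-trans r< (R≤tmp 1))))
                   (k₁ (<-≤-trans r< (R≤tmp 0))))
        where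
        open ≡-Reasoning
        ρ₂ = ρ₁ [ tmp 1 ↦ trunc 0 ]
        ρ₃ = ρ₂ [ reg x ↦ trunc (ρ₂ (tmp 0) + ρ₂ (tmp 1)) ]
        value : ρ₃ (reg x) ≡ eval η μ e
        value = begin
          ρ₃ (reg x)                        ≡⟨ update-at ρ₂ (reg x) _ refl ⟩
          trunc (ρ₂ (tmp 0) + ρ₂ (tmp 1))
            ≡⟨ cong₂ (λ p q → trunc (p + q))
                 (trans (update-other ρ₁ _ _ (<⇒≢ (tmp<tmp (s≤s z≤n)))) v₁)
                 (trans (update-at ρ₁ (tmp 1) _ refl) trunc0) ⟩
          trunc (eval η μ e + 0)            ≡⟨ cong trunc (+-identityʳ _) ⟩
          trunc (eval η μ e)                ≡⟨ trunc-id (eval< {η} {μ} e η≤ rd sz) ⟩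
          eval η μ e                        ∎
        agree : Agree (η [ x ]≔ eval η μ e) ρ₃
        agree y with y ≟F x
        ... | yes refl = trans value (sym (lookup∘update x η _))
        ... | no y≢x   = begin
          ρ₃ (reg y)  ≡⟨ update-other ρ₂ _ _ (y≢x ∘ reg-injective) ⟩
          ρ₂ (reg y)  ≡⟨ update-other ρ₁ _ _ (<⇒≢ (reg<tmp y 1)) ⟩
          ρ₁ (reg y)  ≡⟨ k₁ (reg<tmp y 0) ⟩
          ρ (reg y)   ≡⟨ ag y ⟩
          lookup η y  ≡⟨ lookup∘update′ y≢x η _ ⟨
          lookup (η [ x ]≔ eval η μ e) y ∎

      run-set : ∀ x {k η μ} → k ≤ X → Run (reg x ≔ k) η μ (η [ x ]≔ k) μ 1
      run-set x {k} {η} k≤ .run ρ ag =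
        _ , const , agree , λ r< → update-other ρ _ _ (<⇒≢ (<-≤-trans r< (R≤reg x)))
        where
        agree : Agree (η [ x ]≔ k) (ρ [ reg x ↦ trunc k ])
        agree y with y ≟F x
        ... | yes refl = trans (update-at ρ (reg x) _ refl)
                           (trans (trunc-id (fits k≤)) (sym (lookup∘update x η k)))
        ... | no y≢x   = trans (update-other ρ _ _ (y≢x ∘ reg-injective))
                           (trans (ag y) (sym (lookup∘update′ y≢x η k)))

      run-put : ∀ a e {η μ} → All (_≤ X) η → Reads X η μ a → size a ≤ 200 →
                Reads X η μ e → size e ≤ 200 →
                Run (put a e) η μ η (μ [ eval η μ a ↦ eval η μ e ]) (putCost a e)
      run-put a e {η} {μ} η≤ ra sa re se .run ρ ag with compile-correct a 0 ag η≤ ra sa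
      ... | ρ₁ , x₁ , v₁ , k₁
        with compile-correct e 1 {ρ = ρ₁} (λ x → trans (k₁ (reg<tmp x 0)) (ag x)) η≤ re se
      ... | ρ₂ , x₂ , v₂ , k₂ =
        ρ₂ ,
        subst (λ m → Exec (put a e) (state ρ μ) (state ρ₂ m) (putCost a e))
              (cong₂ (λ p q → μ [ p ↦ q ]) (trans (k₂ (tmp<tmp (s≤s z≤n))) v₁) v₂)
              (seq x₁ (seq x₂ store)) ,
        (λ x → trans (k₂ (reg<tmp x 1)) (trans (k₁ (reg<tmp x 0)) (ag x))) ,
        λ r< → trans (k₂ (<-≤-trans r< (R≤tmp 1))) (k₁ (<-≤-trans r< (R≤tmp 0)))

      env : ℕ → ℕ → ℕ → ℕ → ℕ → ℕ → Env
      env n d c j f a = n ∷ d ∷ c ∷ j ∷ f ∷ a ∷ []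

      module Loop {n d c₀} (n≤ : n ≤ X) (d≤ : d ≤ X) (c₀≤ : c₀ ≤ X) where

        1≤X : 1 ≤ X
        1≤X = ≤-trans (s≤s z≤n) 2≤X

        env≤ : ∀ {j f a} → j ≤ X → f ≤ 1 → a ≤ X → All (_≤ X) (env n d c₀ j f a)
        env≤ j≤ f≤ a≤ = n≤ ∷ d≤ ∷ c₀≤ ∷ j≤ ∷ ≤-trans f≤ 1≤X ∷ a≤ ∷ []

        -- Loop bounds and base addresses are evaluated again in every pass, so they must be
        -- independent of everything a loop changes: counter, flag, accumulator and memory.
        Constant : Expr → ℕ → Set
        Constant e L = ∀ {j f a μ} → Reads X (env n d c₀ j f a) μ e × eval (env n d c₀ j f a) μ e ≡ L

        -- `A` and `μ` are the traces of the accumulator and of the memory over the passes. Filling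
        -- loops keep `A` fixed, the counting loop keeps `μ` fixed.
        run-for : ∀ e body {L b} (A : ℕ → ℕ) (μ : ℕ → Mem) →
          Constant e L → suc (size e) ≤ 200 → L ≤ X → (∀ {k} → k ≤ L → A k ≤ X) →
          (∀ {k} → k < L → Run body (env n d c₀ k 1 (A k)) (μ k) (env n d c₀ k 1 (A (suc k))) (μ (suc k)) b) →
          ∀ {j f} → j ≤ X → f ≤ 1 →
          Run (for e body) (env n d c₀ j f (A 0)) (μ 0) (env n d c₀ L 0 (A L)) (μ L) (forCost e b L)
        run-for e body {L} {b} A μ const-e size-e L≤X A≤ step {j} {f} j≤ f≤ =
          run-assign jᵛ (lit 0) (env≤ j≤ f≤ (A≤ z≤n)) tt (s≤s z≤n) ⟫
          test z≤n f≤ (A≤ z≤n) ⟫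
          iterate L (+-identityʳ L)
          where
          flag : ℕ → ℕ
          flag k = fromBool (k <ᵇ L)
          testᶜ nextᶜ : Cmd
          testᶜ = assign fᵛ (var jᵛ ⊲ e)
          nextᶜ = assign jᵛ (var jᵛ ⊕ lit 1)
          test : ∀ {k f a μ} → k ≤ L → f ≤ 1 → a ≤ X →
                 Run testᶜ (env n d c₀ k f a) μ (env n d c₀ k (flag k) a) μ (assignCost (var jᵛ ⊲ e))
          test {k} {f} {a} {μ} k≤ f≤ a≤ =
            subst (λ v → Run testᶜ (env n d c₀ k f a) μ
                             (env n d c₀ k (fromBool (k <ᵇ v)) a) μ (assignCost (var jᵛ ⊲ e)))
              (proj₂ (const-e {k} {f} {a} {μ}))
              (run-assign fᵛ (var jᵛ ⊲ e) (env≤ (≤-trans k≤ L≤X) f≤ a≤)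
                (tt , proj₁ (const-e {k} {f} {a} {μ})) size-e)
          next : ∀ {k a μ} → k ≤ L → a ≤ X →
                 Run nextᶜ (env n d c₀ k 1 a) μ (env n d c₀ (suc k) 1 a) μ (assignCost (var jᵛ ⊕ lit 1))
          next {k} {a} {μ} k≤ a≤ =
            subst (λ v → Run nextᶜ (env n d c₀ k 1 a) μ (env n d c₀ v 1 a) μ (assignCost (var jᵛ ⊕ lit 1)))
              (+-comm k 1)
              (run-assign jᵛ (var jᵛ ⊕ lit 1) (env≤ (≤-trans k≤ L≤X) ≤-refl a≤) (tt , tt)
                (s≤s (s≤s (s≤s z≤n))))
          iterate : ∀ m {k} → m + k ≡ L →
            Run (while≢0 (reg fᵛ) (body ⨾ nextᶜ ⨾ testᶜ))
                (env n d c₀ k (flag k) (A k)) (μ k) (env n d c₀ L 0 (A L)) (μ L)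
                (loopCost (b + (assignCost (var jᵛ ⊕ lit 1) + assignCost (var jᵛ ⊲ e))) m)
          iterate zero    refl .run ρ ag
            rewrite dec-false (L <? L) (<-irrefl refl) = ρ , stop (ag fᵛ) , ag , λ _ → refl
          iterate (suc m) {k} m+k≡L .run ρ ag
            with dec-true (k <? L) (≤-trans (s≤s (m≤n+m k m)) (≤-reflexive m+k≡L))
               | ≤-trans (s≤s (m≤n+m k m)) (≤-reflexive m+k≡L)
          ... | k<ᵇL | k<L rewrite k<ᵇL
            with (step k<L ⟫ next (<⇒≤ k<L) (A≤ k<L) ⟫ test k<L ≤-refl (A≤ k<L)) .run ρ ag
          ... | ρ₁ , x₁ , ag₁ , lo₁
            with iterate m (trans (+-suc m k) m+k≡L) .run ρ₁ ag₁
          ... | ρ₂ , x₂ , ag₂ , lo₂ =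
            ρ₂ , loop (λ f≡0 → 1≢0 (trans (sym (ag fᵛ)) f≡0)) x₁ x₂ , ag₂ ,
            λ r< → trans (lo₂ r<) (lo₁ r<)
            where
            1≢0 : 1 ≢ 0
            1≢0 ()

        module _ {U} (1≤U : 1 ≤ U) (U≤X : U ≤ X) {a} (a≤ : a ≤ X) where

          run-fill : ∀ base c e {p L f j₀ f₀ μ} →
            Constant base p → size base + 1 ≤ 200 → Constant c L → suc (size c) ≤ 200 → L ≤ X →
            size e ≤ 200 →
            (∀ {k} → k < L → Reads X (env n d c₀ k 1 a) (writes μ p f k) e
                           × eval (env n d c₀ k 1 a) (writes μ p f k) e ≡ f k) →
            j₀ ≤ X → f₀ ≤ 1 →
            Run (fill base c e) (env n d c₀ j₀ f₀ a) μ (env n d c₀ L 0 a) (writes μ p f L)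
                (forCost c (putCost (base ⊕ var jᵛ) e) L)
          run-fill base c e {p} {L} {f} {μ = μ} const-base size-base const-c size-c L≤ size-e value j≤ f≤ =
            run-for c (put (base ⊕ var jᵛ) e) (λ _ → a) (writes μ p f) const-c size-c L≤ (λ _ → a≤) step j≤ f≤
            where
            step : ∀ {k} → k < L →
              Run (put (base ⊕ var jᵛ) e) (env n d c₀ k 1 a) (writes μ p f k)
                  (env n d c₀ k 1 a) (writes μ p f (suc k)) (putCost (base ⊕ var jᵛ) e)
            step {k} k< =
              subst (λ m → Run (put (base ⊕ var jᵛ) e) (env n d c₀ k 1 a) (writes μ p f k)
                               (env n d c₀ k 1 a) m (putCost (base ⊕ var jᵛ) e))
                (cong₂ (λ x y → writes μ p f k [ x ↦ y ])
                  (cong (_+ k) (proj₂ const-base)) (proj₂ (value k<)))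
                (run-put (base ⊕ var jᵛ) e (env≤ (<⇒≤ (<-≤-trans k< L≤)) ≤-refl a≤)
                  (proj₁ const-base , tt) size-base (proj₁ (value k<)) size-e)

          -- The output overwrites memory below `B` while it is being computed. Hence the value of
          -- an entry is required in every memory that agrees with `ν` from `B` on, whatever the
          -- lower cells contain.
          Segment : Mem → ℕ → Expr × Expr → ℕ × (ℕ → ℕ) → Set
          Segment ν B (c , e) (L , f) =
            Constant c L × L ≤ U ×
            (∀ {μ k} → (∀ {i} → B ≤ i → μ i ≡ ν i) → k < L →
              Reads X (env n d c₀ k 1 a) μ e × eval (env n d c₀ k 1 a) μ e ≡ f k)

          Emission : Expr → List (Expr × Expr) → List (ℕ × (ℕ → ℕ)) → ℕ → ℕ → ℕ → Mem → Set
          Emission base ss ls p j₀ f₀ μ =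
            Σ Mem λ μ′ → Σ ℕ λ j₁ → Σ ℕ λ f₁ → Σ ℕ λ t →
            Run (emit base ss) (env n d c₀ j₀ f₀ a) μ (env n d c₀ j₁ f₁ a) μ′ t
            × j₁ ≤ X × f₁ ≤ 1 × t ≤ emitBound base ss * U
            × (∀ {i} → i < p → μ′ i ≡ μ i)
            × (∀ {i} → i < length (segments ls) → μ′ (p + i) ≡ trunc (at (segments ls) i))
            × (∀ {i} → p + length (segments ls) ≤ i → μ′ i ≡ μ i)

          run-emit : ∀ {ν B} base ss {ls p j₀ f₀ μ} →
            Constant base p → Sized base ss → Pointwise (Segment ν B) ss ls →
            p + length (segments ls) ≤ B → (∀ {i} → B ≤ i → μ i ≡ ν i) → j₀ ≤ X → f₀ ≤ 1 →
            Emission base ss ls p j₀ f₀ μ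
          run-emit base [] {p = p} {j₀ = j₀} {f₀} {μ} _ _ [] _ _ j≤ f≤ =
            μ , j₀ , f₀ , 1 , record { run = λ ρ ag → ρ , skip , ag , λ _ → refl } ,
            j≤ , f≤ , ≤-trans 1≤U (≤-reflexive (sym (+-identityʳ U))) ,
            (λ _ → refl) , (λ ()) , λ _ → refl
          run-emit {ν} {B} base ((c , e) ∷ ss) {(L , f) ∷ ls} {p} {μ = μ} const-base
                   (size-base , size-c , size-e , sized) ((const-c , L≤U , value) ∷ segs) ≤B same j≤ f≤
            with run-emit (base ⊕ c) ss {p = p + L} {μ = writes μ p f L}
                   ((proj₁ const-base , proj₁ const-c) , cong₂ _+_ (proj₂ const-base) (proj₂ const-c))
                   sized segs
                   (≤-trans (≤-reflexive (sym total)) ≤B)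
                   (unchanged L ≤-refl) (≤-trans L≤U U≤X) z≤n
            where
            total = length-segments-∷ p L f ls
            p+L≤B : p + L ≤ B
            p+L≤B = ≤-trans (m+n≤o⇒m≤o (p + L) (≤-reflexive (sym total))) ≤B
            unchanged : ∀ k → k ≤ L → ∀ {i} → B ≤ i → writes μ p f k i ≡ ν i
            unchanged k k≤ B≤i =
              trans (writes-above μ p f k (≤-trans (≤-trans (+-monoʳ-≤ p k≤) p+L≤B) B≤i)) (same B≤i)
          ... | μ′ , j₁ , f₁ , t , r , j₁≤ , f₁≤ , t≤ , below , inside , above =
            μ′ , j₁ , f₁ , _ ,
            run-fill base c e const-base size-base const-c size-c (≤-trans L≤U U≤X) size-e
              (λ {k} k< → value (λ B≤i → trans (writes-above μ p f k
                 (≤-trans (+-monoʳ-≤ p (<⇒≤ k<)) (≤-trans p+L≤B B≤i))) (same B≤i)) k<) j≤ f≤ ⟫ r ,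
            j₁≤ , f₁≤ ,
            ≤-trans (+-mono-≤ (forCost≤ c (putCost (base ⊕ var jᵛ) e) 1≤U L≤U) t≤)
              (≤-reflexive (sym (*-distribʳ-+ U (forBound c (putCost (base ⊕ var jᵛ) e)) _))) ,
            (λ i< → trans (below (<-≤-trans i< (m≤m+n p L))) (writes-below μ p f L i<)) ,
            inside′ ,
            λ {i} ≤i → trans (above (≤-trans (≤-reflexive (sym total)) ≤i))
              (writes-above μ p f L (≤-trans (≤-trans (m≤m+n _ _) (≤-reflexive (sym total))) ≤i))
            where
            total = length-segments-∷ p L f ls
            p+L≤B : p + L ≤ B
            p+L≤B = ≤-trans (m+n≤o⇒m≤o (p + L) (≤-reflexive (sym total))) ≤B
            inside′ : ∀ {i} → i < length (segments ((L , f) ∷ ls)) →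
                      μ′ (p + i) ≡ trunc (at (segments ((L , f) ∷ ls)) i)
            inside′ {i} i< with i <? L
            ... | yes i<L = begin
              μ′ (p + i)             ≡⟨ below (+-monoʳ-< p i<L) ⟩
              writes μ p f L (p + i) ≡⟨ writes-inside μ p f i<L ⟩
              f i                    ≡⟨ trunc-id f< ⟨
              trunc (f i)            ≡⟨ cong trunc (at-applyUpTo f i<L) ⟨
              trunc (at (applyUpTo f L) i)
                ≡⟨ cong trunc
                     (at-++ˡ (applyUpTo f L) (≤-trans i<L (≤-reflexive (sym (length-applyUpTo f L))))) ⟨
              trunc (at (segments ((L , f) ∷ ls)) i) ∎
              where
              open ≡-Reasoning
              -- Serves only to bound `f i`: as the value of a small expression it is below `2 ^ w`,
              -- so the truncation in the specification does nothing.
              v = value {μ} {i} same i<L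
              f< : f i < 2 ^ w
              f< = subst (_< 2 ^ w) (proj₂ v)
                     (eval< e (env≤ (<⇒≤ (<-≤-trans i<L (≤-trans L≤U U≤X))) ≤-refl a≤) (proj₁ v) size-e)
            ... | no i≮L = begin
              μ′ (p + i)             ≡⟨ cong (λ x → μ′ (p + x)) (sym i≡) ⟩
              μ′ (p + (L + i′))      ≡⟨ cong μ′ (+-assoc p L i′) ⟨
              μ′ (p + L + i′)        ≡⟨ inside (+-cancelˡ-< L _ _ (subst₂ _<_ (sym i≡) len i<)) ⟩
              trunc (at (segments ls) i′)    ≡⟨ cong trunc (at-++ʳ (applyUpTo f L) i′) ⟨
              trunc (at (applyUpTo f L ++ segments ls) (length (applyUpTo f L) + i′))
                ≡⟨ cong (λ x → trunc (at (applyUpTo f L ++ segments ls) x))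
                     (trans (cong (_+ i′) (length-applyUpTo f L)) i≡) ⟩
              trunc (at (segments ((L , f) ∷ ls)) i) ∎
              where
              open ≡-Reasoning
              i′ = i ∸ L
              i≡ : L + i′ ≡ i
              i≡ = m+[n∸m]≡n (≮⇒≥ i≮L)
              len : length (segments ((L , f) ∷ ls)) ≡ L + length (segments ls)
              len = length-segments-∷ 0 L f ls

  -- The range mode instance

  mod-+ : ∀ b k → (b + k) mod b ≡ k mod b
  mod-+ zero    k = refl
  mod-+ (suc b) k = trans (cong (_% suc b) (+-comm (suc b) k)) ([m+n]%n≡m%n k (suc b))

  div-+ : ∀ {b} → 0 < b → ∀ k → (b + k) div b ≡ suc (k div b)
  div-+ {suc b} _ k =
    trans (m/n≡1+[m∸n]/n (m≤m+n (suc b) k)) (cong (λ x → suc (x / suc b)) (m+n∸m≡n (suc b) k))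

  mod-< : ∀ {b k} → k < b → k mod b ≡ k
  mod-< {suc b} k<b = m<n⇒m%n≡m k<b

  div-< : ∀ {b k} → k < b → k div b ≡ 0
  div-< {suc b} k<b = m<n⇒m/n≡0 k<b

  mod-bound : ∀ {b} k → 0 < b → k mod b < b
  mod-bound {suc b} k _ = m%n<n k (suc b)

  div-bound : ∀ {a b k} → k < a * b → k div b < a
  div-bound {a} {zero}  k< = contradiction (≤-trans k< (≤-reflexive (*-zeroʳ a))) λ ()
  div-bound {a} {suc b} k< = m<n*o⇒m/o<n k<

  div-mod-id : ∀ {b} → 0 < b → ∀ k → k ≡ k mod b + k div b * b
  div-mod-id {suc b} _ k = m≡m%n+[m/n]*n k (suc b)

  mod-combine : ∀ q {r b} → r < b → (q * b + r) mod b ≡ r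
  mod-combine zero    r<b = mod-< r<b
  mod-combine (suc q) {r} {b} r<b =
    trans (cong (_mod b) (+-assoc b (q * b) r)) (trans (mod-+ b (q * b + r)) (mod-combine q r<b))

  div-combine : ∀ q {r b} → r < b → (q * b + r) div b ≡ q
  div-combine zero    r<b = div-< r<b
  div-combine (suc q) {r} {b} r<b =
    trans (cong (_div b) (+-assoc b (q * b) r))
      (trans (div-+ (≤-trans (s≤s z≤n) r<b) (q * b + r)) (cong suc (div-combine q r<b)))

  combine-< : ∀ {q a r b} → q < a → r < b → q * b + r < a * b
  combine-< {q} {a} {r} {b} q<a r<b =
    ≤-trans (≤-trans (≤-reflexive (sym (+-suc (q * b) r)))
      (≤-trans (+-monoʳ-≤ (q * b) r<b) (≤-reflexive (+-comm (q * b) b)))) (*-monoˡ-≤ b q<a)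

  -- Lists and sums over initial segments of ℕ

  module _ {ℓ} {A : Set ℓ} where

    applyUpTo-cong : ∀ {f g : ℕ → A} k → (∀ {i} → i < k → f i ≡ g i) → applyUpTo f k ≡ applyUpTo g k
    applyUpTo-cong zero    f≡g = refl
    applyUpTo-cong (suc k) f≡g = cong₂ _∷_ (f≡g (s≤s z≤n)) (applyUpTo-cong k (f≡g ∘ s≤s))

    applyUpTo-+ : ∀ (f : ℕ → A) a b → applyUpTo f (a + b) ≡ applyUpTo f a ++ applyUpTo (f ∘ (a +_)) b
    applyUpTo-+ f zero    b = refl
    applyUpTo-+ f (suc a) b = cong (f 0 ∷_) (applyUpTo-+ (f ∘ suc) a b)

    -- Row-major order: entry `k` of a table of width `b` sits in row `k div b` and column
    -- `k mod b`. For `b = 0` both sides are empty, so the default values of `div` and `mod` do not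
    -- matter.
    concat-applyUpTo : ∀ (h : ℕ → ℕ → A) a b →
      List.concat (applyUpTo (λ i → applyUpTo (h i) b) a) ≡ applyUpTo (λ k → h (k div b) (k mod b)) (a * b)
    concat-applyUpTo h a zero = trans (nil {h} a) (cong (applyUpTo _) (sym (*-zeroʳ a)))
      where
      nil : ∀ {h : ℕ → ℕ → A} a → List.concat (applyUpTo (λ i → applyUpTo (h i) 0) a) ≡ []
      nil         zero    = refl
      nil {h = h} (suc a) = nil {h = h ∘ suc} a
    concat-applyUpTo h zero    (suc b) = refl
    concat-applyUpTo h (suc a) B@(suc b) = begin
      applyUpTo (h 0) B ++ List.concat (applyUpTo (λ i → applyUpTo (h (suc i)) B) a)
        ≡⟨ cong₂ _++_
             (applyUpTo-cong B (λ k< → sym (cong₂ h (div-< k<) (mod-< k<))))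
             (trans (concat-applyUpTo (h ∘ suc) a B)
               (applyUpTo-cong (a * B) λ {k} _ → sym (cong₂ h (div-+ (s≤s z≤n) k) (mod-+ B k)))) ⟩
      applyUpTo f B ++ applyUpTo (f ∘ (B +_)) (a * B)  ≡⟨ applyUpTo-+ f B (a * B) ⟨
      applyUpTo f (suc a * B)                          ∎
      where
      open ≡-Reasoning
      f = λ k → h (k div B) (k mod B)

    tabulate-toℕ : ∀ (f : ℕ → A) k → List.tabulate {n = k} (f ∘ toℕ) ≡ applyUpTo f k
    tabulate-toℕ f zero    = refl
    tabulate-toℕ f (suc k) = cong (f 0 ∷_) (tabulate-toℕ (f ∘ suc) k)

    toList-tabulate-toℕ : ∀ (f : ℕ → A) k → Vec.toList (Vec.tabulate {n = k} (f ∘ toℕ)) ≡ applyUpTo f k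
    toList-tabulate-toℕ f zero    = refl
    toList-tabulate-toℕ f (suc k) = cong (f 0 ∷_) (toList-tabulate-toℕ (f ∘ suc) k)

    ∈-applyUpTo : ∀ {x : A} (f : ℕ → A) k → x ∈ˡ applyUpTo f k → ∃ λ i → x ≡ f i
    ∈-applyUpTo f (suc k) (here e)  = 0 , e
    ∈-applyUpTo f (suc k) (there p) with ∈-applyUpTo (f ∘ suc) k p
    ... | i , e = suc i , e

  sumTo : ℕ → (ℕ → ℕ) → ℕ
  sumTo zero    f = 0
  sumTo (suc k) f = f 0 + sumTo k (f ∘ suc)

  sumTo-cong : ∀ k {f g} → (∀ {i} → i < k → f i ≡ g i) → sumTo k f ≡ sumTo k g
  sumTo-cong zero    f≡g = refl
  sumTo-cong (suc k) f≡g = cong₂ _+_ (f≡g (s≤s z≤n)) (sumTo-cong k (f≡g ∘ s≤s))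

  sumTo-zero : ∀ k {f} → (∀ {i} → i < k → f i ≡ 0) → sumTo k f ≡ 0
  sumTo-zero zero    f≡0 = refl
  sumTo-zero (suc k) f≡0 = cong₂ _+_ (f≡0 (s≤s z≤n)) (sumTo-zero k (f≡0 ∘ s≤s))

  sumTo-+ : ∀ a b f → sumTo (a + b) f ≡ sumTo a f + sumTo b (f ∘ (a +_))
  sumTo-+ zero    b f = refl
  sumTo-+ (suc a) b f = trans (cong (f 0 +_) (sumTo-+ a b (f ∘ suc))) (sym (+-assoc (f 0) _ _))

  sumTo-* : ∀ a b f → sumTo (a * b) f ≡ sumTo a (λ i → sumTo b (λ r → f (i * b + r)))
  sumTo-* zero    b f = refl
  sumTo-* (suc a) b f = trans (sumTo-+ b (a * b) f)
    (cong (sumTo b f +_) (trans (sumTo-* a b (f ∘ (b +_)))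
      (sumTo-cong a λ {i} _ → sumTo-cong b λ {r} _ → cong f (sym (+-assoc b (i * b) r)))))

  sumTo-single : ∀ k {f r} → r < k → (∀ {i} → i < k → i ≢ r → f i ≡ 0) → sumTo k f ≡ f r
  sumTo-single (suc k) {f} {zero} r< f≡0 =
    trans (cong (f 0 +_) (sumTo-zero k (λ i< → f≡0 (s≤s i<) λ ()))) (+-identityʳ _)
  sumTo-single (suc k) {f} {suc r} r< f≡0 =
    cong₂ _+_ (f≡0 (s≤s z≤n) λ ()) (sumTo-single k (s≤s⁻¹ r<) λ i< i≢r → f≡0 (s≤s i<) (i≢r ∘ suc-injective))

  sumTo≤ : ∀ k {f} → (∀ i → f i ≤ 1) → sumTo k f ≤ k
  sumTo≤ zero    f≤1 = z≤n
  sumTo≤ (suc k) f≤1 = +-mono-≤ (f≤1 0) (sumTo≤ k (f≤1 ∘ suc))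

  -- If a term were 0, the others, at most 1 each, could not make up the sum. This recovers, from a
  -- frequency equal to the ceiling, a condition on every coordinate.
  sumTo-full : ∀ k {f} → (∀ i → f i ≤ 1) → sumTo k f ≡ k → ∀ {i} → i < k → f i ≡ 1
  sumTo-full (suc k) {f} f≤1 full {i} i< with f 0 in e | f≤1 0
  ... | 0 | _ = contradiction (≤-trans (≤-reflexive (sym full)) (sumTo≤ k (f≤1 ∘ suc))) (<-irrefl refl)
  ... | 1 | _ with i
  ... | zero   = e
  ... | suc i′ = sumTo-full k (f≤1 ∘ suc) (suc-injective full) (s≤s⁻¹ i<)
  sumTo-full (suc k) f≤1 full i< | suc (suc _) | s≤s ()

  sumTo-ones : ∀ k {f} → (∀ {i} → i < k → f i ≡ 1) → sumTo k f ≡ k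
  sumTo-ones zero    ones = refl
  sumTo-ones (suc k) ones = cong₂ _+_ (ones (s≤s z≤n)) (sumTo-ones k (ones ∘ s≤s))

  ≡ᵇ-true : ∀ {a b} → a ≡ b → (a ≡ᵇ b) ≡ true
  ≡ᵇ-true {a} {b} = dec-true (a ≟ b)

  ≡ᵇ-false : ∀ {a b} → a ≢ b → (a ≡ᵇ b) ≡ false
  ≡ᵇ-false {a} {b} = dec-false (a ≟ b)

  [≡]-cong : ∀ {a b c d} → (a ≡ b → c ≡ d) → (c ≡ d → a ≡ b) → fromBool (a ≡ᵇ b) ≡ fromBool (c ≡ᵇ d)
  [≡]-cong {a} {b} f g with a ≟ b
  ... | yes p = trans (cong fromBool (≡ᵇ-true p)) (cong fromBool (sym (≡ᵇ-true (f p))))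
  ... | no ¬p = trans (cong fromBool (≡ᵇ-false ¬p)) (cong fromBool (sym (≡ᵇ-false (¬p ∘ g))))

  [≡]≡1 : ∀ {a b} → fromBool (a ≡ᵇ b) ≡ 1 → a ≡ b
  [≡]≡1 {a} {b} e with a ≟ b
  ... | yes p = p
  ... | no ¬p = contradiction (trans (sym (cong fromBool (≡ᵇ-false ¬p))) e) λ ()

  length-filter-tabulate : ∀ {a p} {A : Set a} {P : Pred A p} (P? : Decidable P) k (f : Fin k → A) h →
    (∀ i → h (toℕ i) ≡ fromBool (does (P? (f i)))) → length (filter P? (List.tabulate f)) ≡ sumTo k h
  length-filter-tabulate P? zero    f h h≡ = refl
  length-filter-tabulate P? (suc k) f h h≡ with does (P? (f zero)) | h≡ zero
  ... | true  | e = trans (cong suc (length-filter-tabulate P? k (f ∘ suc) (h ∘ suc) (h≡ ∘ suc)))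
                      (cong (_+ sumTo k (h ∘ suc)) (sym e))
  ... | false | e = trans (length-filter-tabulate P? k (f ∘ suc) (h ∘ suc) (h≡ ∘ suc))
                      (cong (_+ sumTo k (h ∘ suc)) (sym e))

  does-≟F : ∀ {k} (i j : Fin k) → does (i ≟F j) ≡ (toℕ i ≡ᵇ toℕ j)
  does-≟F i j with i ≟F j
  ... | yes e = sym (≡ᵇ-true (cong toℕ e))
  ... | no ¬e = sym (≡ᵇ-false (¬e ∘ toℕ-injective))

  toℕ-modF : ∀ {k b} .{{_ : NonZero b}} → k < b → toℕ (k modF b) ≡ k
  toℕ-modF k<b = trans (toℕ-fromℕ< _) (m<n⇒m%n≡m k<b)

  -- Index `i` is position `suc i`, so the query bounds select `b ≤ i < b + l`. Splitting the sum at
  -- `b` and `b + l` leaves the middle stretch, because the indicator vanishes on the other two.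
  frequency≡ : ∀ {σ N} (T : Vec (Fin σ) N) (τ : ℕ → ℕ) → (∀ i → toℕ (lookup T i) ≡ τ (toℕ i)) →
    ∀ b l → b + l ≤ N → ∀ c →
    frequency T b (b + l) c ≡ sumTo l (λ k → fromBool (τ (b + k) ≡ᵇ toℕ c))
  frequency≡ {N = N} T τ τ≡ b l b+l≤N c = begin
    frequency T b (b + l) c
      ≡⟨ length-filter-tabulate _ N (λ i → i) h
           (λ i → cong (λ q → fromBool (does (b <? suc (toℕ i)) ∧ does (suc (toℕ i) ≤? b + l) ∧ q))
             (sym (trans (does-≟F (lookup T i) c) (cong (_≡ᵇ toℕ c) (τ≡ i))))) ⟩
    sumTo N h                              ≡⟨ cong (λ k → sumTo k h) (sym (m+[n∸m]≡n b+l≤N)) ⟩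
    sumTo (b + l + r) h                    ≡⟨ sumTo-+ (b + l) r h ⟩
    sumTo (b + l) h + sumTo r (h ∘ (b + l +_))
      ≡⟨ cong₂ _+_ (sumTo-+ b l h) (sumTo-zero r λ {i} _ → after i) ⟩
    sumTo b h + sumTo l (h ∘ (b +_)) + 0   ≡⟨ +-identityʳ _ ⟩
    sumTo b h + sumTo l (h ∘ (b +_))
      ≡⟨ cong₂ _+_ (sumTo-zero b before) (sumTo-cong l inside) ⟩
    sumTo l (λ k → fromBool (τ (b + k) ≡ᵇ toℕ c)) ∎
    where
    open ≡-Reasoning
    r = N ∸ (b + l)
    h : ℕ → ℕ
    h k = fromBool (does (b <? suc k) ∧ does (suc k ≤? b + l) ∧ (τ k ≡ᵇ toℕ c))
    before : ∀ {i} → i < b → h i ≡ 0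
    before {i} i<b rewrite dec-false (b <? suc i) (≤⇒≯ i<b) = refl
    after : ∀ i → h (b + l + i) ≡ 0
    after i rewrite dec-false (suc (b + l + i) ≤? b + l) (m+n≮m (b + l) i) = cong fromBool (∧-zeroʳ _)
    inside : ∀ {i} → i < l → h (b + i) ≡ fromBool (τ (b + i) ≡ᵇ toℕ c)
    inside {i} i<l
      rewrite dec-true (b <? suc (b + i)) (s≤s (m≤m+n b i))
            | dec-true (suc (b + i) ≤? b + l) (+-monoʳ-< b i<l) = refl

  *-^-distrib : ∀ a b k → (a * b) ^ k ≡ a ^ k * b ^ k
  *-^-distrib a b zero    = refl
  *-^-distrib a b (suc k) =
    trans (cong (a * b *_) (*-^-distrib a b k)) ([m*n]*[o*p]≡[m*o]*[n*p] a b (a ^ k) (b ^ k))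

  sum-tabulate-const : ∀ k {n} (f : Fin k → ℕ) → (∀ i → f i ≡ n) → sum (List.tabulate f) ≡ k * n
  sum-tabulate-const zero    f f≡ = refl
  sum-tabulate-const (suc k) f f≡ = cong₂ _+_ (f≡ zero) (sum-tabulate-const k (f ∘ suc) (f≡ ∘ suc))

  -- A derivation from left to right; `pre` collects what has already been rewritten.
  expand-all : ∀ {v σ} (G : SLG v σ) pre (f : ℕ → Fin v) k →
    Star (_⇒_ G) (pre ++ applyUpTo (nonterminal ∘ f) k)
                 (pre ++ List.concat (applyUpTo (SLG.rhs G ∘ f) k))
  expand-all G pre f zero    = Star.ε
  expand-all G pre f (suc k) =
    rewrite-at pre (f 0) _ ◅
    subst₂ (Star (_⇒_ G)) (++-assoc pre _ _) (++-assoc pre _ _)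
      (expand-all G (pre ++ SLG.rhs G (f 0)) (f ∘ suc) k)

  -- Here g x i is bit i of the extended vector x; sel p is the row used at
  -- position p of the start rule, and τ k the letter at position k.
  module Construction (κ : ℚᵘ) (1≤κ : 1 ≤ num κ) {n d : ℕ} (1≤n : 1 ≤ n) (g : ℕ → ℕ → ℕ)
    (g≤1 : ∀ {x i} → x < n → i < suc (suc d) → g x i ≤ 1) (g0 : ∀ x → g x 0 ≡ 0) where

    -- `n * D + D * n` is the grammar size: the start rule has `n * D` symbols, and there are `D`
    -- rows of `n` letters. Thus `m` is `num κ` times the grammar size, a logarithmic factor above
    -- what the lower bound on `m` asks for, which the running time can afford.
    D N σ m : ℕ
    D = suc (suc d)
    N = n * D * n
    σ = num κ * N
    m = num κ * (n * D + D * n)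

    sel τ : ℕ → ℕ
    letter : ℕ → ℕ → ℕ
    sel p = g (p div D) (p mod D) * (p mod D)
    letter s y = y + n * g y s
    τ k = letter (sel (k div n)) (k mod n)

    n+n≤nD : n + n ≤ n * D
    n+n≤nD = ≤-trans (≤-reflexive (trans (cong (n +_) (sym (+-identityʳ n))) (*-comm 2 n)))
               (*-monoʳ-≤ n (s≤s (s≤s z≤n)))

    nD≤N : n * D ≤ N
    nD≤N = m≤m*n (n * D) n {{>-nonZero 1≤n}}

    N≤σ : N ≤ σ
    N≤σ = m≤n*m N (num κ) {{>-nonZero 1≤κ}}

    2≤N : 2 ≤ N
    2≤N = ≤-trans (+-mono-≤ 1≤n 1≤n) (≤-trans n+n≤nD nD≤N)

    instance
      σ≢0 : NonZero σ
      σ≢0 = >-nonZero (≤-trans (s≤s z≤n) (≤-trans 2≤N N≤σ))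

    p-bound : ∀ {p} → p < n * D → p div D < n × p mod D < D
    p-bound {p} p< = div-bound p< , mod-bound p (s≤s z≤n)

    sel< : ∀ {p} → p < n * D → sel p < D
    sel< {p} p< with g (p div D) (p mod D) | g≤1 (proj₁ (p-bound p<)) (proj₂ (p-bound p<))
    ... | 0 | _ = s≤s z≤n
    ... | 1 | _ = ≤-trans (s≤s (≤-reflexive (+-identityʳ _))) (proj₂ (p-bound p<))
    ... | suc (suc _) | s≤s ()

    letter< : ∀ {s y} → s < D → y < n → letter s y < σ
    letter< {s} {y} s< y< =
      ≤-trans (+-mono-≤ y< (≤-trans (*-monoʳ-≤ n (g≤1 y< s<)) (≤-reflexive (*-identityʳ n))))
        (≤-trans n+n≤nD (≤-trans nD≤N N≤σ))

    τ< : ∀ {k} → k < N → τ k < σ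
    τ< {k} k< = letter< (sel< (div-bound k<)) (mod-bound k 1≤n)

    letters : ℕ → List (Symbol (suc D) σ)
    letters s = applyUpTo (λ y → terminal (letter s y modF σ)) n

    rules : Fin (suc D) → List (Symbol (suc D) σ)
    rules zero    = applyUpTo (λ p → nonterminal (suc (sel p modF D))) (n * D)
    rules (suc i) = letters (toℕ i)

    G : SLG (suc D) σ
    G = record
      { start   = zero
      ; rhs     = rules
      ; order   = Permutation.id
      ; acyclic = acyclic
      }
      where
      acyclic : ∀ i j → nonterminal j ∈ˡ rules i → i Fin.< j
      acyclic zero    j j∈ with ∈-applyUpTo _ (n * D) j∈
      ... | p , refl = s≤s z≤n
      acyclic (suc i) j j∈ with ∈-applyUpTo _ n j∈
      ... | y , ()

    T : Vec (Fin σ) N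
    T = Vec.tabulate (λ i → τ (toℕ i) modF σ)

    T-lookup : ∀ i → toℕ (lookup T i) ≡ τ (toℕ i)
    T-lookup i = trans (cong toℕ (lookup∘tabulate _ i)) (toℕ-modF (τ< (toℕ<n i)))

    represents : Represents G T
    represents =
      rewrite-at [] zero [] ◅
      subst₂ (Star (_⇒_ G)) (sym (++-identityʳ _)) (sym word)
        (expand-all G [] (λ p → suc (sel p modF D)) (n * D))
      where
      open ≡-Reasoning
      word : List.map terminal (Vec.toList T) ≡
             List.concat (applyUpTo (λ p → letters (toℕ (sel p modF D))) (n * D))
      word = begin
        List.map terminal (Vec.toList T)
          ≡⟨ cong (List.map terminal) (toList-tabulate-toℕ (λ k → τ k modF σ) N) ⟩
        List.map terminal (applyUpTo (λ k → τ k modF σ) N)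
          ≡⟨ map-applyUpTo _ terminal N ⟩
        applyUpTo (λ k → terminal (τ k modF σ)) N
          ≡⟨ concat-applyUpTo (λ p y → terminal (letter (sel p) y modF σ)) (n * D) n ⟨
        List.concat (applyUpTo (letters ∘ sel) (n * D))
          ≡⟨ cong List.concat (applyUpTo-cong (n * D) λ p< → cong letters (sym (toℕ-modF (sel< p<)))) ⟩
        List.concat (applyUpTo (λ p → letters (toℕ (sel p modF D))) (n * D)) ∎

    size-G : grammarSize G ≡ n * D + D * n
    size-G = cong₂ _+_
      (trans (cong (_⊔ 1) (length-applyUpTo _ (n * D))) (m≥n⇒m⊔n≡m (≤-trans 1≤n (m≤m*n n D))))
      (trans (cong sum (map-tabulate suc (λ N → length (rules N) ⊔ 1)))
        (sum-tabulate-const D (λ i → length (letters (toℕ i)) ⊔ 1) λ i →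
          trans (cong (_⊔ 1) (length-applyUpTo (λ y → terminal {suc D} (letter (toℕ i) y modF σ)) n))
            (m≥n⇒m⊔n≡m 1≤n)))

    -- `r = 0` and `r = 1` give the two ends of a block. Reducing `j` modulo `n` makes the queries
    -- run through the blocks cyclically.
    position : ℕ → ℕ → ℕ
    position j r = (j mod n + r) * (D * n)

    position≤ : ∀ j {r} → r ≤ 1 → position j r ≤ N
    position≤ j {r} r≤ = ≤-trans
      (*-monoˡ-≤ (D * n) (≤-trans (+-monoʳ-≤ (j mod n) r≤)
        (≤-trans (≤-reflexive (+-comm _ 1)) (mod-bound j 1≤n))))
      (≤-reflexive (sym (*-assoc n D n)))

    query : ℕ → Fin (suc N) × Fin (suc N)
    query j = position j 0 modF suc N , position j 1 modF suc N

    instance′ : RangeModeInstance κ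
    instance′ = record
      { G          = G
      ; T          = T
      ; queries    = Vec.tabulate {n = m} (query ∘ toℕ)
      ; represents = represents
      ; N≥2        = 2≤N
      ; σ-large    = begin
          num κ ^ 2 * N                          ≤⟨ *-monoʳ-≤ (num κ ^ 2)
              (≤-trans (m≤m*n N N) (≤-reflexive (cong (N *_) (sym (*-identityʳ N))))) ⟩
          num κ ^ 2 * N ^ 2                      ≡⟨ *-^-distrib (num κ) N 2 ⟨
          σ ^ 2                                  ≤⟨ m≤m*n (σ ^ 2) ⌊log₂ N ⌋ ⟩
          σ ^ 2 * ⌊log₂ N ⌋                      ≤⟨ m≤n*m _ (den κ ^ 2) ⟩
          den κ ^ 2 * (σ ^ 2 * ⌊log₂ N ⌋)        ∎
      ; m-large    = begin
          num κ * grammarSize G                  ≡⟨ cong (num κ *_) size-G ⟩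
          m                                      ≤⟨ m≤m*n m ⌊log₂ N ⌋ ⟩
          m * ⌊log₂ N ⌋                          ≤⟨ m≤n*m _ (den κ) ⟩
          den κ * (m * ⌊log₂ N ⌋)                ∎
      }
      where
      open ≤-Reasoning
      instance
        N≢0 : NonZero N
        N≢0 = >-nonZero (≤-trans (s≤s z≤n) 2≤N)
        log≢0 : NonZero ⌊log₂ N ⌋
        log≢0 = >-nonZero (⌊log₂⌋-mono-≤ {2} 2≤N)
        den²≢0 : NonZero (den κ ^ 2)
        den²≢0 = m^n≢0 (den κ) 2

    -- Entry 0 is the length that precedes a right-hand side in the encoding; the successor in the
    -- other entries is there because letters are numbered from 1.
    rowEntry : ℕ → ℕ → ℕ
    rowEntry i zero    = n
    rowEntry i (suc y) = suc (letter i y)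

    layout : List (ℕ × (ℕ → ℕ))
    layout =
      (1     , λ _ → suc D) ∷
      (1     , λ _ → σ) ∷
      (1     , λ _ → suc (σ + 0)) ∷
      (1     , λ _ → n * D) ∷
      (n * D , λ p → suc (σ + suc (sel p))) ∷
      (D * suc n , λ k → rowEntry (k div suc n) (k mod suc n)) ∷
      (1     , λ _ → m) ∷
      (m * 2 , λ k → position (k div 2) (k mod 2)) ∷ []

    encode≡layout : encodeRangeMode instance′ ≡ segments layout
    encode≡layout = cong (λ xs → suc D ∷ σ ∷ suc (σ + 0) ∷ xs)
      (cong₂ _∷_ (length-applyUpTo _ (n * D))
        (trans (++-assoc (List.map encodeSymbol (rules zero)) others (m ∷ pairs))
          (cong₂ _++_ start≡ (cong₂ _++_ others≡
            (cong (m ∷_) (trans pairs≡ (sym (++-identityʳ _))))))))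
      where
      open ≡-Reasoning
      entry : Fin (suc D) → List ℕ
      entry N = length (rules N) ∷ List.map encodeSymbol (rules N)
      pair : Fin (suc N) × Fin (suc N) → List ℕ
      pair (b , e) = toℕ b ∷ toℕ e ∷ []
      others pairs : List ℕ
      others = concatMap entry (List.tabulate {n = D} suc)
      pairs  = concatMap pair (Vec.toList (Vec.tabulate {n = m} (query ∘ toℕ)))

      start≡ : List.map encodeSymbol (rules zero) ≡ applyUpTo (λ p → suc (σ + suc (sel p))) (n * D)
      start≡ = trans (map-applyUpTo _ encodeSymbol (n * D))
        (applyUpTo-cong (n * D) λ p< → cong (λ x → suc (σ + suc x)) (toℕ-modF (sel< p<)))

      row : ∀ (i : Fin D) → entry (suc i) ≡ applyUpTo (rowEntry (toℕ i)) (suc n)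
      row i = cong₂ _∷_ (length-applyUpTo _ n)
        (trans (map-applyUpTo _ encodeSymbol n)
          (applyUpTo-cong n λ y< → cong suc (toℕ-modF (letter< (toℕ<n i) y<))))

      others≡ : others ≡ applyUpTo (λ k → rowEntry (k div suc n) (k mod suc n)) (D * suc n)
      others≡ = begin
        List.concat (List.map entry (List.tabulate {n = D} suc))
          ≡⟨ cong List.concat (trans (map-tabulate suc entry) (tabulate-cong row)) ⟩
        List.concat (List.tabulate {n = D} (λ i → applyUpTo (rowEntry (toℕ i)) (suc n)))
          ≡⟨ cong List.concat (tabulate-toℕ (λ i → applyUpTo (rowEntry i) (suc n)) D) ⟩
        List.concat (applyUpTo (λ i → applyUpTo (rowEntry i) (suc n)) D)
          ≡⟨ concat-applyUpTo rowEntry D (suc n) ⟩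
        applyUpTo (λ k → rowEntry (k div suc n) (k mod suc n)) (D * suc n) ∎

      pairs≡ : pairs ≡ applyUpTo (λ k → position (k div 2) (k mod 2)) (m * 2)
      pairs≡ = begin
        List.concat (List.map pair (Vec.toList (Vec.tabulate {n = m} (query ∘ toℕ))))
          ≡⟨ cong (List.concat ∘ List.map pair) (toList-tabulate-toℕ query m) ⟩
        List.concat (List.map pair (applyUpTo query m))
          ≡⟨ cong List.concat (map-applyUpTo query pair m) ⟩
        List.concat (applyUpTo (pair ∘ query) m)
          ≡⟨ cong List.concat (applyUpTo-cong m λ {j} _ → cong₂ (λ b e → b ∷ e ∷ [])
               (toℕ-modF (s≤s (position≤ j z≤n))) (toℕ-modF (s≤s (position≤ j ≤-refl)))) ⟩
        List.concat (applyUpTo (λ j → applyUpTo (position j) 2) m)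
          ≡⟨ concat-applyUpTo position m 2 ⟩
        applyUpTo (λ k → position (k div 2) (k mod 2)) (m * 2) ∎

    answer : ℕ → ℕ
    answer j = modeFreq T (proj₁ (query j)) (proj₂ (query j))

    -- The choice of a row performs the multiplication: for `x[i] = 1` it is row `i`, and for
    -- `x[i] = 0` it is row 0, in which every `y` has bit 0.
    product-g : ∀ {x i} → x < n → i < D → ∀ y → g y (g x i * i) ≡ g x i * g y i
    product-g {x} {i} x< i< y with g x i | g≤1 x< i<
    ... | 0 | _ = g0 y
    ... | 1 | _ = trans (cong (g y) (+-identityʳ i)) (sym (+-identityʳ _))
    ... | suc (suc _) | s≤s ()

    -- Write `c` as a residue `y = c mod n` and a quotient. Each row has exactly one letter with
    -- residue `y`, so row `i` of block `x` contributes one occurrence of `c` exactly if `x[i] y[i]`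
    -- is that quotient. Letters from `2n` on get frequency 0 by the same formula.
    frequency-answer : ∀ j c →
      frequency T (toℕ (proj₁ (query j))) (toℕ (proj₂ (query j))) c ≡
      sumTo D (λ i → fromBool (g (j mod n) i * g (toℕ c mod n) i ≡ᵇ toℕ c div n))
    frequency-answer j c = begin
      frequency T (toℕ (proj₁ (query j))) (toℕ (proj₂ (query j))) c
        ≡⟨ cong₂ (λ b e → frequency T b e c) left right ⟩
      frequency T b (b + D * n) c
        ≡⟨ frequency≡ T τ T-lookup b (D * n) b+Dn≤N c ⟩
      sumTo (D * n) (λ k → fromBool (τ (b + k) ≡ᵇ toℕ c))
        ≡⟨ sumTo-* D n _ ⟩
      sumTo D (λ i → sumTo n (λ y → fromBool (τ (b + (i * n + y)) ≡ᵇ toℕ c)))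
        ≡⟨ sumTo-cong D inner ⟩
      sumTo D (λ i → fromBool (g x i * g (toℕ c mod n) i ≡ᵇ toℕ c div n)) ∎
      where
      open ≡-Reasoning
      x b : ℕ
      x = j mod n
      b = x * (D * n)
      x< : x < n
      x< = mod-bound j 1≤n
      left : toℕ (proj₁ (query j)) ≡ b
      left = trans (toℕ-modF (s≤s (position≤ j z≤n))) (cong (_* (D * n)) (+-identityʳ x))
      shift : position j 1 ≡ b + D * n
      shift = trans (cong (_* (D * n)) (+-comm x 1)) (+-comm (D * n) b)
      right : toℕ (proj₂ (query j)) ≡ b + D * n
      right = trans (toℕ-modF (s≤s (position≤ j ≤-refl))) shift
      b+Dn≤N : b + D * n ≤ N
      b+Dn≤N = ≤-trans (≤-reflexive (sym shift)) (position≤ j ≤-refl)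
      τ≡ : ∀ {i y} → i < D → y < n → τ (b + (i * n + y)) ≡ y + n * (g x i * g y i)
      τ≡ {i} {y} i< y< = begin
        τ (b + (i * n + y))
          ≡⟨ cong τ regroup ⟩
        τ ((x * D + i) * n + y)
          ≡⟨ cong₂ (λ p z → letter (sel p) z) (div-combine (x * D + i) y<) (mod-combine (x * D + i) y<) ⟩
        letter (sel (x * D + i)) y
          ≡⟨ cong₂ (λ p i → letter (g p i * i) y) (div-combine x i<) (mod-combine x i<) ⟩
        y + n * g y (g x i * i)
          ≡⟨ cong (λ z → y + n * z) (product-g x< i< y) ⟩
        y + n * (g x i * g y i) ∎
        where
        regroup : b + (i * n + y) ≡ (x * D + i) * n + y
        regroup = trans (sym (+-assoc b (i * n) y)) (cong (_+ y)
          (trans (cong (_+ i * n) (sym (*-assoc x D n))) (sym (*-distribʳ-+ n (x * D) i))))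
      inner : ∀ {i} → i < D →
        sumTo n (λ y → fromBool (τ (b + (i * n + y)) ≡ᵇ toℕ c)) ≡
        fromBool (g x i * g (toℕ c mod n) i ≡ᵇ toℕ c div n)
      inner {i} i< = begin
        sumTo n (λ y → fromBool (τ (b + (i * n + y)) ≡ᵇ toℕ c))
          ≡⟨ sumTo-cong n (λ y< → cong (λ z → fromBool (z ≡ᵇ toℕ c)) (τ≡ i< y<)) ⟩
        sumTo n (λ y → fromBool (y + n * γ y ≡ᵇ toℕ c))
          -- Column `y` only produces letters congruent to `y` modulo `n`, so a single column can
          -- contain `c`.
          ≡⟨ sumTo-single n r< (λ y< y≢r → cong fromBool (≡ᵇ-false λ e → y≢r (remainder y< e))) ⟩
        fromBool (r + n * γ r ≡ᵇ toℕ c)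
          ≡⟨ [≡]-cong (quotient r<) (λ e → trans (cong (r +_) (trans (*-comm n _) (cong (_* n) e))) (sym c≡)) ⟩
        fromBool (γ r ≡ᵇ toℕ c div n) ∎
        where
        γ : ℕ → ℕ
        γ y = g x i * g y i
        r = toℕ c mod n
        r< = mod-bound (toℕ c) 1≤n
        c≡ = div-mod-id 1≤n (toℕ c)
        swap : ∀ y → y + n * γ y ≡ γ y * n + y
        swap y = trans (+-comm y _) (cong (_+ y) (*-comm n (γ y)))
        remainder : ∀ {y} → y < n → y + n * γ y ≡ toℕ c → y ≡ r
        remainder {y} y< e = trans (sym (mod-combine (γ y) y<)) (cong (_mod n) (trans (sym (swap y)) e))
        quotient : ∀ {y} → y < n → y + n * γ y ≡ toℕ c → γ y ≡ toℕ c div n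
        quotient {y} y< e = trans (sym (div-combine (γ y) y<)) (cong (_div n) (trans (sym (swap y)) e))

    match : ℕ → Fin σ → ℕ → Bool
    match j c i = g (j mod n) i * g (toℕ c mod n) i ≡ᵇ toℕ c div n

    Orthogonal : ℕ → ℕ → Set
    Orthogonal x y = ∀ {i} → i < D → g x i * g y i ≡ 0

    answer≤ : ∀ j → answer j ≤ D
    answer≤ j = max≤v⁺ z≤n (All-map⁺ (ListAll.universal (λ c →
      ≤-trans (≤-reflexive (frequency-answer j c)) (sumTo≤ D λ i → fromBool≤1 (match j c i))) (allFin σ)))

    -- The letter `y` itself is the witness: its quotient by `n` is 0, so it occurs in all `D` rows
    -- of the block.
    answer-complete : ∀ j {y} → y < n → Orthogonal (j mod n) y → answer j ≡ D
    answer-complete j {y} y< orth = ≤-antisym (answer≤ j)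
      (v≤max⁺ 0 _ (inj₂ (Any.map (λ e → ≤-reflexive (trans (sym freq≡D) e))
        (∈-map⁺ (frequency T _ _) (∈-allFin (y modF σ))))))
      where
      y<σ : y < σ
      y<σ = ≤-trans y< (≤-trans (m≤m*n n D) (≤-trans nD≤N N≤σ))
      freq≡D : frequency T (toℕ (proj₁ (query j))) (toℕ (proj₂ (query j))) (y modF σ) ≡ D
      freq≡D = trans (frequency-answer j (y modF σ)) (sumTo-ones D λ {i} i< → cong fromBool (≡ᵇ-true (begin
        g (j mod n) i * g (toℕ (y modF σ) mod n) i
          ≡⟨ cong (λ z → g (j mod n) i * g z i) (trans (cong (_mod n) (toℕ-modF y<σ)) (mod-< y<)) ⟩
        g (j mod n) i * g y i  ≡⟨ orth i< ⟩
        0                      ≡⟨ trans (cong (_div n) (toℕ-modF y<σ)) (div-< y<) ⟨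
        toℕ (y modF σ) div n   ∎)))
        where open ≡-Reasoning

    -- The first coordinate is 0 in every vector, so a letter of frequency D is below n.
    answer-sound : ∀ j → answer j ≡ D → Σ ℕ λ y → y < n × Orthogonal (j mod n) y
    answer-sound j e
      with argmax-sel id 0
        (List.map (frequency T (toℕ (proj₁ (query j))) (toℕ (proj₂ (query j)))) (allFin σ))
    ... | inj₁ zero≡ = contradiction (trans (sym zero≡) e) λ ()
    ... | inj₂ max∈ with ∈-map⁻ _ max∈
    ... | c , _ , max≡ =
      toℕ c mod n , mod-bound (toℕ c) 1≤n , λ i< → trans (ones i<)
        (trans (sym (ones (s≤s z≤n))) (cong (_* g (toℕ c mod n) 0) (g0 (j mod n))))
      where
      ones : ∀ {i} → i < D → g (j mod n) i * g (toℕ c mod n) i ≡ toℕ c div n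
      ones i< = [≡]≡1 (sumTo-full D (λ i → fromBool≤1 (match j c i))
        (trans (sym (frequency-answer j c)) (trans (sym max≡) e)) i<)

  -- The input vectors as memory cells

  bitRow : ∀ {d} → Vec (Fin 2) d → List ℕ
  bitRow v = List.map toℕ (Vec.toList v)

  length-bitRow : ∀ {d} (v : Vec (Fin 2) d) → length (bitRow v) ≡ d
  length-bitRow v = trans (length-map toℕ (Vec.toList v)) (length-toList v)

  at-bitRow : ∀ {d} (v : Vec (Fin 2) d) i → at (bitRow v) (toℕ i) ≡ toℕ (lookup v i)
  at-bitRow (b ∷ v) zero    = refl
  at-bitRow (b ∷ v) (suc i) = at-bitRow v i

  bitRows : ∀ {d k} → Vec (Vec (Fin 2) d) k → List ℕ
  bitRows A = concatMap bitRow (Vec.toList A)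

  length-bitRows : ∀ {d k} (A : Vec (Vec (Fin 2) d) k) → length (bitRows A) ≡ k * d
  length-bitRows []      = refl
  length-bitRows (v ∷ A) = trans (length-++ (bitRow v)) (cong₂ _+_ (length-bitRow v) (length-bitRows A))

  at-bitRows : ∀ {d k} (A : Vec (Vec (Fin 2) d) k) x i →
               at (bitRows A) (toℕ x * d + toℕ i) ≡ toℕ (lookup (lookup A x) i)
  at-bitRows (v ∷ A) zero i =
    trans (at-++ˡ (bitRow v) (≤-trans (toℕ<n i) (≤-reflexive (sym (length-bitRow v))))) (at-bitRow v i)
  at-bitRows {d} (v ∷ A) (suc x) i = begin
    at (bitRow v ++ bitRows A) (d + toℕ x * d + toℕ i)
      ≡⟨ cong (at (bitRow v ++ bitRows A))
           (trans (+-assoc d _ _) (cong (_+ (toℕ x * d + toℕ i)) (sym (length-bitRow v)))) ⟩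
    at (bitRow v ++ bitRows A) (length (bitRow v) + (toℕ x * d + toℕ i))
      ≡⟨ at-++ʳ (bitRow v) _ ⟩
    at (bitRows A) (toℕ x * d + toℕ i)  ≡⟨ at-bitRows A x i ⟩
    toℕ (lookup (lookup A x) i)         ∎
    where open ≡-Reasoning

  at≤ : ∀ {b} xs → (∀ {x} → x ∈ˡ xs → x ≤ b) → ∀ i → at xs i ≤ b
  at≤ []       ≤b i       = z≤n
  at≤ (x ∷ xs) ≤b zero    = ≤b (here refl)
  at≤ (x ∷ xs) ≤b (suc i) = at≤ xs (≤b ∘ there) i

  bits≤1 : ∀ {d k} (A : Vec (Vec (Fin 2) d) k) i → at (bitRows A) i ≤ 1
  bits≤1 A = at≤ (bitRows A) bound
    where
    bound : ∀ {x} → x ∈ˡ bitRows A → x ≤ 1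
    bound x∈ with ∈-concatMap⁻ bitRow {xs = Vec.toList A} x∈
    ... | p with satisfied p
    ... | v , x∈v with ∈-map⁻ toℕ x∈v
    ... | b , _ , refl = s≤s⁻¹ (toℕ<n b)

  inner≡0⇒ : ∀ {d} (x y : Vec (Fin 2) d) → ⟨ x , y ⟩ ≡ 0 → ∀ i → toℕ (lookup x i) * toℕ (lookup y i) ≡ 0
  inner≡0⇒ (a ∷ x) (b ∷ y) e zero    = m+n≡0⇒m≡0 (toℕ a * toℕ b) e
  inner≡0⇒ (a ∷ x) (b ∷ y) e (suc i) = inner≡0⇒ x y (m+n≡0⇒n≡0 (toℕ a * toℕ b) e) i

  ⇒inner≡0 : ∀ {d} (x y : Vec (Fin 2) d) → (∀ i → toℕ (lookup x i) * toℕ (lookup y i) ≡ 0) → ⟨ x , y ⟩ ≡ 0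
  ⇒inner≡0 []      []      e = refl
  ⇒inner≡0 (a ∷ x) (b ∷ y) e = cong₂ _+_ (e zero) (⇒inner≡0 x y (e ∘ suc))

  ∈⇒lookup : ∀ {a} {A : Set a} {k} {x : A} {xs : Vec A k} → x ∈ xs → ∃ λ i → lookup xs i ≡ x
  ∈⇒lookup (here refl) = zero , refl
  ∈⇒lookup (there p) with ∈⇒lookup p
  ... | i , e = suc i , e

  -- Two zero coordinates are put in front of every vector, so that N ≥ 2 even
  -- when d = 0.
  module Extended {c : ℕ} (I : OVInstance c) where
    open OVInstance I

    -- The two new coordinates cancel against the two header cells holding `n` and `d`: bit `i − 2`
    -- of vector `x` is stored at `2 + x * d + (i − 2) = x * d + i`. For `i < 2` the cell read is
    -- arbitrary and the factor makes the entry 0.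
    ext : ℕ → ℕ → ℕ
    ext x i = fromBool (1 <ᵇ i) * at (encodeOV I) (x * d + i)

    ext-lookup : ∀ x i → ext (toℕ x) (suc (suc (toℕ i))) ≡ toℕ (lookup (lookup A x) i)
    ext-lookup x i = trans (+-identityʳ _) (trans
      (cong (at (encodeOV I))
        (trans (+-suc (toℕ x * d) (suc (toℕ i))) (cong suc (+-suc (toℕ x * d) (toℕ i)))))
      (at-bitRows A x i))

    ext≤1 : ∀ {x i} → x < n → i < suc (suc d) → ext x i ≤ 1
    ext≤1 {x} {0}           x< i< = z≤n
    ext≤1 {x} {1}           x< i< = z≤n
    ext≤1 {x} {suc (suc i)} x< (s≤s (s≤s i<)) = begin
      ext x (suc (suc i))
        ≡⟨ cong₂ (λ x i → ext x (suc (suc i))) (sym (toℕ-fromℕ< x<)) (sym (toℕ-fromℕ< i<)) ⟩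
      ext (toℕ (fromℕ< x<)) (suc (suc (toℕ (fromℕ< i<))))
        ≡⟨ ext-lookup (fromℕ< x<) (fromℕ< i<) ⟩
      toℕ (lookup (lookup A (fromℕ< x<)) (fromℕ< i<))  ≤⟨ s≤s⁻¹ (toℕ<n _) ⟩
      1 ∎
      where open ≤-Reasoning

    length-input : length (encodeOV I) ≡ 2 + n * d
    length-input = cong (2 +_) (length-bitRows A)

    OrthogonalRows : ℕ → ℕ → Set
    OrthogonalRows x y = ∀ {i} → i < suc (suc d) → ext x i * ext y i ≡ 0

    pair⇒rows : HasOrthogonalPair → Σ ℕ λ x → Σ ℕ λ y → x < n × y < n × OrthogonalRows x y
    pair⇒rows (u , v , u∈ , v∈ , e) with ∈⇒lookup u∈ | ∈⇒lookup v∈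
    ... | x , refl | y , refl = toℕ x , toℕ y , toℕ<n x , toℕ<n y , orth
      where
      orth : OrthogonalRows (toℕ x) (toℕ y)
      orth {0}           i< = refl
      orth {1}           i< = refl
      orth {suc (suc i)} (s≤s (s≤s i<)) =
        subst (λ i → ext (toℕ x) (suc (suc i)) * ext (toℕ y) (suc (suc i)) ≡ 0) (toℕ-fromℕ< i<)
          (trans (cong₂ _*_ (ext-lookup x (fromℕ< i<)) (ext-lookup y (fromℕ< i<)))
            (inner≡0⇒ (lookup A x) (lookup A y) e (fromℕ< i<)))

    rows⇒pair : ∀ {x y} → x < n → y < n → OrthogonalRows x y → HasOrthogonalPair
    rows⇒pair {x} {y} x< y< orth =
      lookup A x′ , lookup A y′ , ∈-lookup x′ A , ∈-lookup y′ A ,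
      ⇒inner≡0 (lookup A x′) (lookup A y′) λ i →
        trans (sym (cong₂ _*_ (ext-lookup x′ i) (ext-lookup y′ i)))
          (trans (cong₂ (λ x y → ext x (suc (suc (toℕ i))) * ext y (suc (suc (toℕ i))))
                        (toℕ-fromℕ< x<) (toℕ-fromℕ< y<))
            (orth (s≤s (s≤s (toℕ<n i)))))
      where
      x′ = fromℕ< x<
      y′ = fromℕ< y<

  -- The reduction program

  -- For closed numbers the implicit argument is solved by evaluation; this checks the sizes of all
  -- concrete expressions against 200.
  numeral≤ : ∀ {a b} {_ : Bool.T (a ≤ᵇ b)} → a ≤ b
  numeral≤ {a} {b} {t} = ≤ᵇ⇒≤ a b t

  -- Bᵉ is the length of the output.  The table of extended vectors starts at
  -- B + D, so that row r = y + 1 of the text reads vector y at B + r D, and the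
  -- length marker r = 0 reads zeros.
  Dᵉ nDᵉ Dnᵉ σᵉ mᵉ Bᵉ iᵉ jᵉ tableᵉ startᵉ rowᵉ pairᵉ : Expr
  jᵉ = var jᵛ
  Dᵉ = lit 2 ⊕ var dᵛ
  nDᵉ = var nᵛ ⊗ Dᵉ
  Dnᵉ = Dᵉ ⊗ var nᵛ
  σᵉ = var cᵛ ⊗ (nDᵉ ⊗ var nᵛ)
  mᵉ = var cᵛ ⊗ (nDᵉ ⊕ Dnᵉ)
  Bᵉ = lit 4 ⊕ (nDᵉ ⊕ (Dᵉ ⊗ (lit 1 ⊕ var nᵛ) ⊕ (lit 1 ⊕ mᵉ ⊗ lit 2)))
  iᵉ = jᵉ ⊙ Dᵉ
  tableᵉ = (lit 1 ⊲ iᵉ) ⊗ ld ((jᵉ ⊘ Dᵉ) ⊗ var dᵛ ⊕ iᵉ)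
  startᵉ = lit 1 ⊕ (σᵉ ⊕ (lit 1 ⊕ ld (Bᵉ ⊕ Dᵉ ⊕ jᵉ) ⊗ iᵉ))
  rowᵉ = (r ⊕ var nᵛ ⊗ ld (Bᵉ ⊕ (r ⊗ Dᵉ ⊕ jᵉ ⊘ suc-n))) ⊕ var nᵛ ⊗ (r ≐ lit 0)
    where
    suc-n r : Expr
    suc-n = lit 1 ⊕ var nᵛ
    r = jᵉ ⊙ suc-n
  pairᵉ = ((jᵉ ⊘ lit 2) ⊙ var nᵛ ⊕ jᵉ ⊙ lit 2) ⊗ Dnᵉ

  output : List (Expr × Expr)
  output =
    (lit 1 , lit 1 ⊕ Dᵉ) ∷
    (lit 1 , σᵉ) ∷
    (lit 1 , lit 1 ⊕ (σᵉ ⊕ lit 0)) ∷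
    (lit 1 , nDᵉ) ∷
    (nDᵉ , startᵉ) ∷
    (Dᵉ ⊗ (lit 1 ⊕ var nᵛ) , rowᵉ) ∷
    (lit 1 , mᵉ) ∷
    (mᵉ ⊗ lit 2 , pairᵉ) ∷ []

  tally : Mem → ℕ → ℕ → ℕ
  tally μ v zero    = 0
  tally μ v (suc k) = tally μ v k + fromBool (μ k ≡ᵇ v)

  tally≤ : ∀ μ v k → tally μ v k ≤ k
  tally≤ μ v zero    = z≤n
  tally≤ μ v (suc k) = ≤-trans (+-mono-≤ (tally≤ μ v k) (fromBool≤1 _)) (≤-reflexive (+-comm k 1))

  tally≡0 : ∀ μ v k → tally μ v k ≡ 0 → ∀ {i} → i < k → μ i ≢ v
  tally≡0 μ v (suc k) e {i} i< μi≡v with i ≟ k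
  ... | yes refl = contradiction (trans (sym (cong fromBool (≡ᵇ-true μi≡v))) (m+n≡0⇒n≡0 (tally μ v k) e)) λ ()
  ... | no i≢k   = tally≡0 μ v k (m+n≡0⇒m≡0 (tally μ v k) e) (≤∧≢⇒< (s≤s⁻¹ i<) i≢k) μi≡v

  tally≢0 : ∀ μ v k → tally μ v k ≢ 0 → Σ ℕ λ i → i < k × μ i ≡ v
  tally≢0 μ v zero    ne = contradiction refl ne
  tally≢0 μ v (suc k) ne with μ k ≟ v
  ... | yes e = k , ≤-refl , e
  ... | no ¬e with tally≢0 μ v k (λ z → ne (cong₂ _+_ z (cong fromBool (≡ᵇ-false ¬e))))
  ... | i , i< , e = i , <-trans i< (n<1+n k) , e

  module Reduction (κ : ℚᵘ) (1≤κ : 1 ≤ num κ) (prog : Cmd) where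

    R : ℕ
    R = registerBound prog

    open Compiler R

    -- `num κ` is set by a bare instruction, since as a literal its size would grow with `κ` beyond
    -- 200. In `scan`, address 0 is written only after the loop, because it holds the answer to the
    -- first query.
    preparation scan program : Cmd
    preparation =
      (reg cᵛ ≔ num κ) ⨾ assign nᵛ (ld (lit 0)) ⨾ assign dᵛ (ld (lit 1)) ⨾
      fill (Bᵉ ⊕ Dᵉ) nDᵉ tableᵉ ⨾ emit (lit 0) output ⨾ fill (Bᵉ ⊕ Dᵉ) nDᵉ (lit 0)
    scan =
      for mᵉ (assign aᵛ (var aᵛ ⊕ (ld jᵉ ≐ Dᵉ))) ⨾ put (lit 0) (lit 0 ⊲ var aᵛ)
    program = preparation ⨾ prog ⨾ scan

    preparationBound scanBound : ℕ
    preparationBound =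
      1 + (assignCost (ld (lit 0)) + (assignCost (ld (lit 1)) +
      (forBound nDᵉ (putCost (Bᵉ ⊕ Dᵉ ⊕ jᵉ) tableᵉ) + (emitBound (lit 0) output +
       forBound nDᵉ (putCost (Bᵉ ⊕ Dᵉ ⊕ jᵉ) (lit 0))))))
    scanBound =
      forBound mᵉ (assignCost (var aᵛ ⊕ (ld jᵉ ≐ Dᵉ))) + putCost (lit 0) (lit 0 ⊲ var aᵛ)

    module Simulation {c} (I : OVInstance c) where
      open OVInstance I using (n; d; A; n≥1; HasOrthogonalPair)
      open Extended I
      open Construction κ 1≤κ {n} {d} n≥1 ext ext≤1 (λ _ → refl)

      -- `U` bounds every loop, the longest writing two words per query, and is the unit for the
      -- overhead. `X` bounds the variables and the words loaded, and is large enough to dominate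
      -- `N` and `σ` as well.
      U X B : ℕ
      U = m * 2
      X = U * suc n
      B = 4 + (n * D + (D * suc n + (1 + m * 2)))

      m≥ : n * D + D * n ≤ m
      m≥ = m≤n*m _ (num κ) {{>-nonZero 1≤κ}}

      m≤U : m ≤ U
      m≤U = m≤m*n m 2

      nD≤m : n * D ≤ m
      nD≤m = ≤-trans (m≤m+n (n * D) (D * n)) m≥

      n≤m : n ≤ m
      n≤m = ≤-trans (m≤m*n n D) nD≤m

      D≤nD : D ≤ n * D
      D≤nD = m≤n*m D n {{>-nonZero n≥1}}

      D≤m : D ≤ m
      D≤m = ≤-trans D≤nD nD≤m

      d≤m : d ≤ m
      d≤m = ≤-trans (≤-trans (n≤1+n d) (n≤1+n (suc d))) D≤m

      κ≤m : num κ ≤ m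
      κ≤m = m≤m*n (num κ) (n * D + D * n)
        {{>-nonZero (≤-trans (s≤s z≤n) (≤-trans D≤nD (m≤m+n (n * D) (D * n))))}}

      1≤U : 1 ≤ U
      1≤U = ≤-trans n≥1 (≤-trans n≤m m≤U)

      rows≤U : D * suc n ≤ U
      rows≤U = ≤-trans (≤-reflexive (*-suc D n)) (≤-trans (+-monoˡ-≤ (D * n) D≤nD) (≤-trans m≥ m≤U))

      U≤X : U ≤ X
      U≤X = m≤m*n U (suc n)

      2≤X : 2 ≤ X
      2≤X = ≤-trans (s≤s (s≤s z≤n)) (≤-trans D≤m (≤-trans m≤U U≤X))

      length-layout : length (segments layout) ≡ B
      length-layout = cong (4 +_)
        (trans (length-++ (applyUpTo (λ p → suc (σ + suc (sel p))) (n * D)))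
          (cong₂ _+_ (length-applyUpTo (λ p → suc (σ + suc (sel p))) (n * D))
            (trans (length-++ (applyUpTo (λ k → rowEntry (k div suc n) (k mod suc n)) (D * suc n)))
              (cong₂ _+_ (length-applyUpTo (λ k → rowEntry (k div suc n) (k mod suc n)) (D * suc n))
                (cong suc (trans (length-++ (applyUpTo (λ k → position (k div 2) (k mod 2)) (m * 2)))
                  (trans (+-identityʳ _) (length-applyUpTo (λ k → position (k div 2) (k mod 2)) (m * 2)))))))))

      length-input≤B : length (encodeOV I) ≤ B
      length-input≤B = ≤-trans (≤-reflexive length-input)
        (+-mono-≤ {2} {4} (s≤s (s≤s z≤n))
          (≤-trans (*-monoʳ-≤ n (≤-trans (n≤1+n d) (n≤1+n (suc d)))) (m≤m+n (n * D) _)))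

      input≤ : ∀ i → at (encodeOV I) i ≤ m
      input≤ 0             = n≤m
      input≤ 1             = d≤m
      input≤ (suc (suc i)) = ≤-trans (bits≤1 A i) (≤-trans n≥1 n≤m)

      module _ {w} (X^200<2^w : X ^ 200 < 2 ^ w) where
        open WordRAM w
        open Semantics {w} 2≤X X^200<2^w

        ≤X : ∀ {k} → k ≤ m → k ≤ X
        ≤X k≤ = ≤-trans k≤ (≤-trans m≤U U≤X)

        open Loop {n} {d} {num κ} (≤X n≤m) (≤X d≤m) (≤X κ≤m)

        μ₀ : Mem
        μ₀ = mem (initial (encodeOV I))

        μ₀≡ : ∀ i → μ₀ i ≡ at (encodeOV I) i
        μ₀≡ i = trans (cong trunc (cell≡at w (encodeOV I) i)) (trunc-id (fits (≤X (input≤ i))))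

        μ₀≤X : ∀ i → μ₀ i ≤ X
        μ₀≤X i = ≤-trans (≤-reflexive (μ₀≡ i)) (≤X (input≤ i))

        table : ℕ → ℕ
        table k = ext (k div D) (k mod D)

        μ₁ : Mem
        μ₁ = writes μ₀ (B + D) table (n * D)

        μ₁-row₀ : ∀ {i} → i < D → μ₁ (B + i) ≡ 0
        μ₁-row₀ {i} i< = trans (writes-below μ₀ (B + D) table (n * D) (+-monoʳ-< B i<))
          (trans (μ₀≡ (B + i)) (at-beyond (encodeOV I) (≤-trans length-input≤B (m≤m+n B i))))

        table≤1 : ∀ {k} → k < n * D → table k ≤ 1
        table≤1 k< = ext≤1 (proj₁ (p-bound k<)) (proj₂ (p-bound k<))

        -- The table is filled while the input is being read, so the cell needed for entry `k` must
        -- lie below the table. As `d ≤ D`, its address is at most `k`.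
        j-bound : ∀ {k} → k < n * D → (k div D) * d + k mod D < B + D
        j-bound {k} k< = ≤-<-trans
          (≤-trans (+-monoˡ-≤ (k mod D) (*-monoʳ-≤ (k div D) (≤-trans (n≤1+n d) (n≤1+n (suc d)))))
            (≤-reflexive (trans (+-comm _ (k mod D)) (sym (div-mod-id (s≤s z≤n) k)))))
          (<-≤-trans k< (≤-trans (≤-trans (m≤m+n (n * D) _) (m≤n+m _ 4)) (m≤m+n B D)))

        module _ {μ : Mem} (same : ∀ {i} → B ≤ i → μ i ≡ μ₁ i) where

          read-table : ∀ {k} → k < n * D → μ (B + D + k) ≡ table k
          read-table {k} k< = trans (same (≤-trans (m≤m+n B D) (m≤m+n (B + D) k)))
            (writes-inside μ₀ (B + D) table k<)

          read-row₀ : ∀ {i} → i < D → μ (B + i) ≡ 0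
          read-row₀ {i} i< = trans (same (m≤m+n B i)) (μ₁-row₀ i<)

          start-value : ∀ {k} → k < n * D →
            Reads X (env n d (num κ) k 1 0) μ startᵉ ×
            eval (env n d (num κ) k 1 0) μ startᵉ ≡ suc (σ + suc (sel k))
          start-value {k} k< =
            (_ , (_ , (_ , ((_ , ≤-trans (≤-trans (≤-reflexive (read-table k<)) (table≤1 k<)) 1≤X) , _)))) ,
            cong (λ x → suc (σ + suc (x * (k mod D)))) (read-table k<)

          row-value : ∀ {k} → k < D * suc n →
            Reads X (env n d (num κ) k 1 0) μ rowᵉ ×
            eval (env n d (num κ) k 1 0) μ rowᵉ ≡ rowEntry (k div suc n) (k mod suc n)
          row-value {k} k<
            with k mod suc n | mod-bound {suc n} k (s≤s z≤n) | k div suc n | div-bound {D} {suc n} k<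
          ... | zero | _ | i | i< =
            ((_ , (_ , (_ , ≤-trans (≤-reflexive (read-row₀ i<)) z≤n))) , _) ,
            trans (cong (λ x → n * x + n * 1) (read-row₀ i<))
              (trans (cong (_+ n * 1) (*-zeroʳ n)) (*-identityʳ n))
          ... | suc y | y< | i | i< =
            ((_ , (_ , (_ , ≤-trans (≤-trans (≤-reflexive entry) (ext≤1 (s≤s⁻¹ y<) i<)) 1≤X))) , _) ,
            trans (cong₂ (λ x z → suc (y + n * x) + z) entry (*-zeroʳ n)) (+-identityʳ _)
            where
            entry : μ (B + (D + y * D + i)) ≡ ext y i
            entry = begin
              μ (B + (D + y * D + i))
                ≡⟨ cong μ (trans (cong (B +_) (+-assoc D (y * D) i)) (sym (+-assoc B D _))) ⟩
              μ (B + D + (y * D + i))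
                ≡⟨ read-table (combine-< (s≤s⁻¹ y<) i<) ⟩
              table (y * D + i)
                ≡⟨ cong₂ ext (div-combine y i<) (mod-combine y i<) ⟩
              ext y i ∎
              where open ≡-Reasoning

        output-segments : Pointwise (Segment 1≤U U≤X z≤n μ₁ B) output layout
        output-segments =
          ((_ , refl) , 1≤U , λ _ _ → _ , refl) ∷
          ((_ , refl) , 1≤U , λ _ _ → _ , refl) ∷
          ((_ , refl) , 1≤U , λ _ _ → _ , refl) ∷
          ((_ , refl) , 1≤U , λ _ _ → _ , refl) ∷
          ((_ , refl) , ≤-trans nD≤m m≤U , λ same → start-value same) ∷
          ((_ , refl) , rows≤U , λ same → row-value same) ∷
          ((_ , refl) , 1≤U , λ _ _ → _ , refl) ∷
          ((_ , refl) , ≤-refl , λ _ _ → _ , refl) ∷ []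

        output-sized : Sized (lit 0) output
        output-sized =
          numeral≤ , numeral≤ , numeral≤ , numeral≤ , numeral≤ , numeral≤ ,
          numeral≤ , numeral≤ , numeral≤ , numeral≤ , numeral≤ , numeral≤ ,
          numeral≤ , numeral≤ , numeral≤ , numeral≤ , numeral≤ , numeral≤ ,
          numeral≤ , numeral≤ , numeral≤ , numeral≤ , numeral≤ , numeral≤ , tt

        read-n : Run (assign nᵛ (ld (lit 0))) (env 0 0 (num κ) 0 0 0) μ₀ (env n 0 (num κ) 0 0 0) μ₀
                     (assignCost (ld (lit 0)))
        read-n = subst
          (λ x → Run (assign nᵛ (ld (lit 0))) (env 0 0 (num κ) 0 0 0) μ₀ (env x 0 (num κ) 0 0 0) μ₀ _)
          (μ₀≡ 0)
          (run-assign nᵛ (ld (lit 0)) (z≤n ∷ z≤n ∷ ≤X κ≤m ∷ z≤n ∷ z≤n ∷ z≤n ∷ []) (tt , μ₀≤X 0) numeral≤)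

        read-d : Run (assign dᵛ (ld (lit 1))) (env n 0 (num κ) 0 0 0) μ₀ (env n d (num κ) 0 0 0) μ₀
                     (assignCost (ld (lit 1)))
        read-d = subst
          (λ x → Run (assign dᵛ (ld (lit 1))) (env n 0 (num κ) 0 0 0) μ₀ (env n x (num κ) 0 0 0) μ₀ _)
          (μ₀≡ 1)
          (run-assign dᵛ (ld (lit 1)) (≤X n≤m ∷ z≤n ∷ ≤X κ≤m ∷ z≤n ∷ z≤n ∷ z≤n ∷ []) (tt , μ₀≤X 1) numeral≤)

        build-table : Run (fill (Bᵉ ⊕ Dᵉ) nDᵉ tableᵉ)
          (env n d (num κ) 0 0 0) μ₀ (env n d (num κ) (n * D) 0 0) μ₁
          (forCost nDᵉ (putCost (Bᵉ ⊕ Dᵉ ⊕ jᵉ) tableᵉ) (n * D))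
        build-table = run-fill 1≤U U≤X z≤n (Bᵉ ⊕ Dᵉ) nDᵉ tableᵉ {p = B + D}
          (_ , refl) numeral≤ (_ , refl) numeral≤ (≤X nD≤m) numeral≤
          (λ {k} k< → (_ , (_ , ≤-trans (≤-reflexive (unwritten k k<)) (μ₀≤X (address k)))) ,
            cong (fromBool (1 <ᵇ k mod D) *_) (trans (unwritten k k<) (μ₀≡ (address k))))
          z≤n z≤n
          where
          address : ℕ → ℕ
          address k = (k div D) * d + k mod D
          unwritten : ∀ k → k < n * D → writes μ₀ (B + D) table k (address k) ≡ μ₀ (address k)
          unwritten k k< = writes-below μ₀ (B + D) table k (j-bound k<)

        clear-table : ∀ {μ j f} → j ≤ X → f ≤ 1 →
          Run (fill (Bᵉ ⊕ Dᵉ) nDᵉ (lit 0)) (env n d (num κ) j f 0) μ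
            (env n d (num κ) (n * D) 0 0) (writes μ (B + D) (λ _ → 0) (n * D))
            (forCost nDᵉ (putCost (Bᵉ ⊕ Dᵉ ⊕ jᵉ) (lit 0)) (n * D))
        clear-table = run-fill 1≤U U≤X z≤n (Bᵉ ⊕ Dᵉ) nDᵉ (lit 0) {p = B + D}
          (_ , refl) numeral≤ (_ , refl) numeral≤ (≤X nD≤m) numeral≤ (λ _ → tt , refl)

        record _≲_ (t k : ℕ) : Set where
          constructor ≲-intro
          field ≲-elim : t ≤ k * U
        open _≲_ public

        infixr 5 _≲+_
        _≲+_ : ∀ {s t x y} → s ≲ x → t ≲ y → (s + t) ≲ (x + y)
        _≲+_ {x = x} {y} (≲-intro s≤) (≲-intro t≤) =
          ≲-intro (≤-trans (+-mono-≤ s≤ t≤) (≤-reflexive (sym (*-distribʳ-+ U x y))))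

        ≲-const : ∀ x → x ≲ x
        ≲-const x = ≲-intro (m≤m*n x U {{>-nonZero 1≤U}})

        ≲-for : ∀ c b {L} → L ≤ U → forCost c b L ≲ forBound c b
        ≲-for c b L≤U = ≲-intro (forCost≤ c b 1≤U L≤U)

        -- `low` and `same` together say that the given program finds its own initial state, as far
        -- as it can see; `agree` keeps the variables alive for the scan after the call.
        record Prepared : Set where
          field
            {ρ}   : Reg → ℕ
            {μ}   : Mem
            {t j f} : ℕ
            executed : Exec preparation (initial (encodeOV I)) (state ρ μ) t
            time     : t ≲ preparationBound
            agree    : Agree (env n d (num κ) j f 0) ρ
            j≤       : j ≤ X
            f≤       : f ≤ 1
            low      : ∀ {r} → r < R → ρ r ≡ 0
            same     : ∀ i → μ i ≡ mem (initial (encodeRangeMode instance′)) i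

        prepare : Prepared
        prepare = after (run-emit 1≤U U≤X z≤n {μ₁} {B} (lit 0) output {p = 0} {μ = μ₁}
                    (_ , refl) output-sized output-segments (≤-reflexive length-layout)
                    (λ _ → refl) (≤X nD≤m) z≤n)
          where
          zeros : Agree (env 0 0 0 0 0 0) (λ _ → 0)
          zeros nᵛ = refl
          zeros dᵛ = refl
          zeros cᵛ = refl
          zeros jᵛ = refl
          zeros fᵛ = refl
          zeros aᵛ = refl
          after : Emission 1≤U U≤X z≤n (lit 0) output layout 0 (n * D) 0 μ₁ → Prepared
          after (μ₂ , j , f , t , emitted , j≤ , f≤ , t≤ , _ , inside , above) =
            finish ((run-set cᵛ {η = env 0 0 0 0 0 0} (≤X κ≤m) ⟫ read-n ⟫ read-d ⟫
                     build-table ⟫ emitted ⟫ clear-table j≤ f≤)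
                      .run (λ _ → 0) zeros)
            where
            μ₃ : Mem
            μ₃ = writes μ₂ (B + D) (λ _ → 0) (n * D)
            -- The input ends by `B`, so cells from there on outside the table still hold their
            -- initial 0.
            untouched : ∀ {i} → B ≤ i → (∀ {k} → k < n * D → i ≢ B + D + k) → μ₁ i ≡ 0
            untouched {i} B≤i i≢ with i <? B + D
            ... | yes i< = trans (writes-below μ₀ (B + D) table (n * D) i<)
                             (trans (μ₀≡ i) (at-beyond (encodeOV I) (≤-trans length-input≤B B≤i)))
            ... | no i≮ with i <? B + D + n * D
            ... | no i≮′ = trans (writes-above μ₀ (B + D) table (n * D) (≮⇒≥ i≮′))
                             (trans (μ₀≡ i) (at-beyond (encodeOV I) (≤-trans length-input≤B B≤i)))
            ... | yes i< = contradiction (sym k≡)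
                             (i≢ (+-cancelˡ-< (B + D) _ _ (≤-<-trans (≤-reflexive k≡) i<)))
              where
              k≡ : B + D + (i ∸ (B + D)) ≡ i
              k≡ = m+[n∸m]≡n (≮⇒≥ i≮)
            layout-value : ∀ i → μ₃ i ≡ trunc (at (segments layout) i)
            layout-value i with i <? B
            ... | yes i<B = trans (writes-below μ₂ (B + D) _ (n * D) (<-≤-trans i<B (m≤m+n B D)))
                              (inside (<-≤-trans i<B (≤-reflexive (sym length-layout))))
            ... | no i≮B = trans zero≡ (sym (trans (cong trunc (at-beyond (segments layout) beyond)) trunc0))
              where
              beyond : length (segments layout) ≤ i
              beyond = ≤-trans (≤-reflexive length-layout) (≮⇒≥ i≮B)
              zero≡ : μ₃ i ≡ 0
              zero≡ with i <? B + D
              ... | yes i< = trans (writes-below μ₂ (B + D) _ (n * D) i<) (trans (above beyond)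
                     (untouched (≮⇒≥ i≮B) λ {k} _ e → <⇒≱ i< (≤-trans (m≤m+n (B + D) k) (≤-reflexive (sym e)))))
              ... | no i≮ with i <? B + D + n * D
              ... | no i≮′ = trans (writes-above μ₂ (B + D) _ (n * D) (≮⇒≥ i≮′)) (trans (above beyond)
                     (untouched (≮⇒≥ i≮B) λ {k} k< e →
                       i≮′ (≤-trans (s≤s (≤-reflexive e)) (+-monoʳ-< (B + D) k<))))
              ... | yes i< = trans (cong μ₃ (sym k≡)) (writes-inside μ₂ (B + D) (λ _ → 0)
                               (+-cancelˡ-< (B + D) _ _ (≤-<-trans (≤-reflexive k≡) i<)))
                where
                k≡ : B + D + (i ∸ (B + D)) ≡ i
                k≡ = m+[n∸m]≡n (≮⇒≥ i≮)
            final : ∀ i → μ₃ i ≡ mem (initial (encodeRangeMode instance′)) i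
            final i = trans (layout-value i)
              (sym (cong trunc
                (trans (cell≡at w (encodeRangeMode instance′) i) (cong (λ xs → at xs i) encode≡layout))))
            finish : (Σ (Reg → ℕ) λ ρ′ →
              Exec preparation (state (λ _ → 0) μ₀) (state ρ′ μ₃) _ ×
              Agree (env n d (num κ) (n * D) 0 0) ρ′ × (∀ {r} → r < R → ρ′ r ≡ 0)) → Prepared
            finish (ρ , executed , agree , low) = record
              { executed = executed
              ; time     = ≲-const 1 ≲+ ≲-const (assignCost (ld (lit 0))) ≲+
                           ≲-const (assignCost (ld (lit 1))) ≲+
                           ≲-for nDᵉ (putCost (Bᵉ ⊕ Dᵉ ⊕ jᵉ) tableᵉ) (≤-trans nD≤m m≤U) ≲+
                           ≲-intro {k = emitBound (lit 0) output} t≤ ≲+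
                           ≲-for nDᵉ (putCost (Bᵉ ⊕ Dᵉ ⊕ jᵉ) (lit 0)) (≤-trans nD≤m m≤U)
              ; agree    = agree
              ; j≤       = ≤X nD≤m
              ; f≤       = z≤n
              ; low      = low
              ; same     = final
              }

        scan-correct : ∀ {μ j f} → (∀ {k} → k < m → μ k ≡ answer k) → j ≤ X → f ≤ 1 →
          Σ ℕ λ t → t ≲ scanBound ×
          Run scan (env n d (num κ) j f 0) μ (env n d (num κ) m 0 (tally μ D m))
              (μ [ 0 ↦ fromBool (0 <ᵇ tally μ D m) ]) t
        scan-correct {μ} correct j≤ f≤ =
          _ , ≲-for mᵉ (assignCost (var aᵛ ⊕ (ld jᵉ ≐ Dᵉ))) m≤U ≲+
              ≲-const (putCost (lit 0) (lit 0 ⊲ var aᵛ)) ,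
          run-for mᵉ (assign aᵛ (var aᵛ ⊕ (ld jᵉ ≐ Dᵉ))) (tally μ D) (λ _ → μ)
            (_ , refl) numeral≤ (≤X ≤-refl) (λ k≤ → ≤X (≤-trans (tally≤ μ D _) k≤))
            (λ {k} k< → run-assign aᵛ (var aᵛ ⊕ (ld jᵉ ≐ Dᵉ))
              (env≤ (≤X (<⇒≤ k<)) ≤-refl (≤X (≤-trans (tally≤ μ D k) (<⇒≤ k<))))
              (_ , ((_ , ≤-trans (≤-reflexive (correct k<)) (≤X (≤-trans (answer≤ k) D≤m))) , _))
              numeral≤)
            j≤ f≤ ⟫
          run-put (lit 0) (lit 0 ⊲ var aᵛ) (env≤ (≤X ≤-refl) z≤n (≤X (tally≤ μ D m)))
            _ numeral≤ _ numeral≤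

        Verdict : Mem → Set
        Verdict μ = (μ 0 ≡ 1 × HasOrthogonalPair) ⊎ (μ 0 ≡ 0 × ¬ HasOrthogonalPair)

        verdict : ∀ {μ} → (∀ {k} → k < m → μ k ≡ answer k) →
                  Verdict (μ [ 0 ↦ fromBool (0 <ᵇ tally μ D m) ])
        verdict {μ} correct with tally μ D m in e
        ... | zero  = inj₂ (refl , none)
          where
          none : ¬ HasOrthogonalPair
          none pair with pair⇒rows pair
          -- Since `x < n ≤ m`, query number `x` exists and asks for block `x`.
          ... | x , y , x< , y< , orth = tally≡0 μ D m e (<-≤-trans x< n≤m)
            (trans (correct (<-≤-trans x< n≤m))
              (answer-complete x y< (subst (λ x → Orthogonal x y) (sym (mod-< x<)) orth)))
        ... | suc _ with tally≢0 μ D m (λ z → contradiction (trans (sym e) z) λ ())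
        ... | j , j< , μj≡D with answer-sound j (trans (sym (correct j<)) μj≡D)
        ... | y , y< , orth = inj₁ (refl , rows⇒pair (mod-bound j n≥1) y< orth)

        record Simulated (t : ℕ) : Set where
          field
            {s}      : State
            {u}      : ℕ
            overhead : u ≲ (preparationBound + scanBound)
            executed : Exec program (initial (encodeOV I)) s (t + u)
            decided  : Verdict (mem s)

        simulate : ∀ {s t} → Exec prog (initial (encodeRangeMode instance′)) s t →
          (∀ {k} → k < m → mem s k ≡ answer k) → Simulated t
        simulate {s} {t} executed correct =
          calling (transport executed ≤-refl P.ρ P.μ (λ r< → sym (P.low r<)) (λ i → sym (P.same i)))
          where
          module P = Prepared prepare
          calling : (Σ (Reg → ℕ) λ ρ′ → Σ Mem λ μ′ →
                     Exec prog (state P.ρ P.μ) (state ρ′ μ′) t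
                     × (∀ {r} → r < R → regs s r ≡ ρ′ r) × (∀ a → mem s a ≡ μ′ a)
                     × (∀ {r} → R ≤ r → ρ′ r ≡ P.ρ r)) → Simulated t
          calling (ρ₂ , μ₂ , x₂ , _ , me , high) = scanning (scan-correct correct₂ P.j≤ P.f≤)
            where
            correct₂ : ∀ {k} → k < m → μ₂ k ≡ answer k
            correct₂ {k} k< = trans (sym (me k)) (correct k<)
            scanning : (Σ ℕ λ t → t ≲ scanBound ×
              Run scan (env n d (num κ) P.j P.f 0) μ₂ (env n d (num κ) m 0 (tally μ₂ D m))
                       (μ₂ [ 0 ↦ fromBool (0 <ᵇ tally μ₂ D m) ]) t) → Simulated t
            scanning (t₃ , t₃≤ , r) = finished (r .run ρ₂ (λ x → trans (high (R≤reg x)) (P.agree x)))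
              where
              finished : (Σ (Reg → ℕ) λ ρ′ →
                Exec scan (state ρ₂ μ₂) (state ρ′ (μ₂ [ 0 ↦ fromBool (0 <ᵇ tally μ₂ D m) ])) t₃
                × Agree (env n d (num κ) m 0 (tally μ₂ D m)) ρ′ × (∀ {r} → r < R → ρ′ r ≡ ρ₂ r)) → Simulated t
              finished (ρ₃ , x₃ , _) = record
                { overhead = P.time ≲+ t₃≤
                ; executed = subst (Exec program (initial (encodeOV I)) _)
                    (trans (sym (+-assoc P.t t t₃)) (trans (cong (_+ t₃) (+-comm P.t t)) (+-assoc t P.t t₃)))
                    (seq P.executed (seq x₂ x₃))
                ; decided  = verdict correct₂
                }

        answers : ∀ {μ} → Problem.Correct (RangeMode κ) instance′ μ → ∀ {k} → k < m → μ k ≡ answer k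
        answers {μ} correct {k} k< = begin
          μ k                       ≡⟨ cong μ (toℕ-fromℕ< k<) ⟨
          μ (toℕ (fromℕ< k<))       ≡⟨ correct (fromℕ< k<) ⟩
          modeFreq T (proj₁ (lookup queries (fromℕ< k<))) (proj₂ (lookup queries (fromℕ< k<)))
            ≡⟨ cong (λ q → modeFreq T (proj₁ q) (proj₂ q)) (lookup∘tabulate (query ∘ toℕ) (fromℕ< k<)) ⟩
          answer (toℕ (fromℕ< k<))  ≡⟨ cong answer (toℕ-fromℕ< k<) ⟩
          answer k                  ∎
          where
          open ≡-Reasoning
          queries = RangeModeInstance.queries instance′

  -- Running time

  1≤bits : ∀ {n} → 1 ≤ n → 1 ≤ bits n
  1≤bits 1≤n = ⌈log₂⌉-mono-≤ {2} (s≤s 1≤n)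

  -- `bits n` is the length of the binary expansion, and halving drops the last digit. The upper
  -- half of `suc n` is `suc ⌊ n /2⌋` by computation.
  bits-half : ∀ {n} → 1 ≤ n → bits n ≡ suc (bits ⌊ n /2⌋)
  bits-half {n} 1≤n = begin
    bits n             ≡⟨ m+[n∸m]≡n (1≤bits 1≤n) ⟨
    suc (bits n ∸ 1)   ≡⟨ cong suc (⌈log₂⌈n/2⌉⌉≡⌈log₂n⌉∸1 (suc n)) ⟨
    suc (bits ⌊ n /2⌋) ∎
    where open ≡-Reasoning

  half-bounds : ∀ n → n ≤ suc (2 * ⌊ n /2⌋)
  half-bounds zero          = z≤n
  half-bounds (suc zero)    = s≤s z≤n
  half-bounds (suc (suc n)) = ≤-trans (s≤s (s≤s (half-bounds n)))
    (≤-reflexive (cong suc (sym (*-suc 2 ⌊ n /2⌋))))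

  double-half≤ : ∀ n → 2 * ⌊ n /2⌋ ≤ n
  double-half≤ zero          = z≤n
  double-half≤ (suc zero)    = z≤n
  double-half≤ (suc (suc n)) = ≤-trans (≤-reflexive (*-suc 2 ⌊ n /2⌋)) (s≤s (s≤s (double-half≤ n)))

  n<2^bits : ∀ n → n < 2 ^ bits n
  n<2^bits = <-rec _ step
    where
    open ≤-Reasoning
    step : ∀ n → (∀ {m} → m < n → m < 2 ^ bits m) → n < 2 ^ bits n
    step zero      rec = s≤s z≤n
    step n@(suc k) rec = begin
      suc n                   ≤⟨ s≤s (half-bounds n) ⟩
      2 + 2 * ⌊ n /2⌋         ≡⟨ *-suc 2 ⌊ n /2⌋ ⟨
      2 * suc ⌊ n /2⌋         ≤⟨ *-monoʳ-≤ 2 (rec (⌊n/2⌋<n k)) ⟩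
      2 ^ suc (bits ⌊ n /2⌋)  ≡⟨ cong (2 ^_) (bits-half {n} (s≤s z≤n)) ⟨
      2 ^ bits n              ∎

  2^bits≤2n : ∀ n → 1 ≤ n → 2 ^ bits n ≤ 2 * n
  2^bits≤2n = <-rec _ step
    where
    open ≤-Reasoning
    step : ∀ n → (∀ {m} → m < n → 1 ≤ m → 2 ^ bits m ≤ 2 * m) → 1 ≤ n → 2 ^ bits n ≤ 2 * n
    step 1               rec _ = ≤-refl
    step n@(suc (suc k)) rec 1≤n = begin
      2 ^ bits n                ≡⟨ cong (2 ^_) (bits-half 1≤n) ⟩
      2 * 2 ^ bits ⌊ n /2⌋      ≤⟨ *-monoʳ-≤ 2 (rec (⌊n/2⌋<n (suc k)) (s≤s z≤n)) ⟩
      2 * (2 * ⌊ n /2⌋)         ≤⟨ *-monoʳ-≤ 2 (double-half≤ n) ⟩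
      2 * n                     ∎

  -- With b = bits n: b < j (⌊b/j⌋ + 1) ≤ j 2^⌊b/j⌋, and the j-th power of the
  -- right-hand side is at most j^j 2^b.
  polylog≤ : ∀ j {n} → 1 ≤ n → bits n ^ j ≤ 2 * j ^ j * n
  polylog≤ zero    {n} 1≤n = ≤-trans 1≤n (m≤n*m n 2)
  polylog≤ j@(suc _) {n} 1≤n = begin
    b ^ j                        ≤⟨ ^-monoˡ-≤ j b≤ ⟩
    (j * 2 ^ (b / j)) ^ j        ≡⟨ *-^-distrib j (2 ^ (b / j)) j ⟩
    j ^ j * (2 ^ (b / j)) ^ j    ≡⟨ cong (j ^ j *_) (^-*-assoc 2 (b / j) j) ⟩
    j ^ j * 2 ^ (b / j * j)      ≤⟨ *-monoʳ-≤ (j ^ j) (^-monoʳ-≤ 2 (m/n*n≤m b j)) ⟩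
    j ^ j * 2 ^ b                ≤⟨ *-monoʳ-≤ (j ^ j) (2^bits≤2n n 1≤n) ⟩
    j ^ j * (2 * n)              ≡⟨ *-assoc (j ^ j) 2 n ⟨
    j ^ j * 2 * n                ≡⟨ cong (_* n) (*-comm (j ^ j) 2) ⟩
    2 * j ^ j * n                ∎
    where
    open ≤-Reasoning
    b = bits n
    suc≤2^ : ∀ x → suc x ≤ 2 ^ x
    suc≤2^ zero    = ≤-refl
    suc≤2^ (suc x) = ≤-trans (+-mono-≤ (m^n>0 2 x) (suc≤2^ x))
      (≤-reflexive (cong (2 ^ x +_) (sym (+-identityʳ _))))
    b≤ : b ≤ j * 2 ^ (b / j)
    b≤ = begin
      b                       ≡⟨ m≡m%n+[m/n]*n b j ⟩
      b % j + b / j * j       ≤⟨ +-monoˡ-≤ _ (<⇒≤ (m%n<n b j)) ⟩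
      suc (b / j) * j         ≤⟨ *-monoˡ-≤ j (suc≤2^ (b / j)) ⟩
      2 ^ (b / j) * j         ≡⟨ *-comm (2 ^ (b / j)) j ⟩
      j * 2 ^ (b / j)         ∎

  x≤x^ : ∀ x k → x ≤ x ^ suc k
  x≤x^ zero      k = z≤n
  x≤x^ x@(suc _) k = ≤-trans (≤-reflexive (sym (*-identityʳ x))) (*-monoʳ-≤ x (m^n>0 x k))

  module _ {n : ℕ} (1≤n : 1 ≤ n) (q′ : ℕ) where
    open ≤-Reasoning

    private
      q r b : ℕ
      q = suc q′
      r = q + q
      b = bits n
      instance
        n≢0 : NonZero n
        n≢0 = >-nonZero 1≤n

    -- Squaring the hypothesis gives two factors `n` on the left. One of them pays for
    -- `b ^ (s * r)`, which is at most a constant times `n`; the other remains as the saving.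
    subquadratic : ∀ E s {t} → t ^ q * n ≤ (E * (n ^ 2 * b ^ s)) ^ q →
                   t ^ r * n ≤ (E * (2 * (s * r) ^ (s * r)) * n ^ 2) ^ r
    subquadratic E s {t} t≤ = *-cancelʳ-≤ (t ^ r * n) _ n (begin
      t ^ r * n * n                    ≡⟨ cong (λ x → x * n * n) (^-distribˡ-+-* t q q) ⟩
      t ^ q * t ^ q * n * n            ≡⟨ lem₁ (t ^ q) n ⟩
      (t ^ q * n) * (t ^ q * n)        ≤⟨ *-mono-≤ t≤ t≤ ⟩
      Z ^ q * Z ^ q                    ≡⟨ ^-distribˡ-+-* Z q q ⟨
      Z ^ r                            ≡⟨ cong (_^ r) (*-assoc E (n ^ 2) (b ^ s)) ⟨
      (E * n ^ 2 * b ^ s) ^ r          ≡⟨ *-^-distrib (E * n ^ 2) (b ^ s) r ⟩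
      (E * n ^ 2) ^ r * (b ^ s) ^ r    ≡⟨ cong ((E * n ^ 2) ^ r *_) (^-*-assoc b s r) ⟩
      (E * n ^ 2) ^ r * b ^ (s * r)    ≤⟨ *-monoʳ-≤ ((E * n ^ 2) ^ r) (polylog≤ (s * r) 1≤n) ⟩
      (E * n ^ 2) ^ r * (c * n)        ≡⟨ *-assoc ((E * n ^ 2) ^ r) c n ⟨
      (E * n ^ 2) ^ r * c * n          ≤⟨ *-monoˡ-≤ n (*-monoʳ-≤ ((E * n ^ 2) ^ r) (x≤x^ c (q′ + q))) ⟩
      (E * n ^ 2) ^ r * c ^ r * n      ≡⟨ cong (_* n) (*-^-distrib (E * n ^ 2) c r) ⟨
      (E * n ^ 2 * c) ^ r * n          ≡⟨ cong (λ x → x ^ r * n) (lem₂ E (n ^ 2) c) ⟩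
      (E * c * n ^ 2) ^ r * n          ∎)
      where
      Z = E * (n ^ 2 * b ^ s)
      c = 2 * (s * r) ^ (s * r)
      lem₁ : ∀ x n → x * x * n * n ≡ (x * n) * (x * n)
      lem₁ = solve-∀
      lem₂ : ∀ x y z → x * y * z ≡ x * z * y
      lem₂ = solve-∀

    -- The logarithm costs one factor `n` and the saving another; both fit into the spare `n ^ r`
    -- because `r ≥ 2`.
    quasilinear : ∀ F {u} → u ≤ F * (n * b) → u ^ r * n ≤ (F * (2 * r ^ r) * n ^ 2) ^ r
    quasilinear F {u} u≤ = begin
      u ^ r * n                          ≤⟨ *-monoˡ-≤ n (^-monoˡ-≤ r u≤) ⟩
      (F * (n * b)) ^ r * n              ≡⟨ cong (λ x → x ^ r * n) (*-assoc F n b) ⟨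
      (F * n * b) ^ r * n                ≡⟨ cong (_* n) (*-^-distrib (F * n) b r) ⟩
      (F * n) ^ r * b ^ r * n            ≤⟨ *-monoˡ-≤ n (*-monoʳ-≤ ((F * n) ^ r) (polylog≤ r 1≤n)) ⟩
      (F * n) ^ r * (c * n) * n          ≡⟨ lem₁ ((F * n) ^ r) c n ⟩
      (F * n) ^ r * c * (n * n)          ≤⟨ *-mono-≤ (*-monoʳ-≤ ((F * n) ^ r) (x≤x^ c (q′ + q))) n²≤ ⟩
      (F * n) ^ r * c ^ r * n ^ r        ≡⟨ cong (_* n ^ r) (*-^-distrib (F * n) c r) ⟨
      (F * n * c) ^ r * n ^ r            ≡⟨ *-^-distrib (F * n * c) n r ⟨
      (F * n * c * n) ^ r                ≡⟨ cong (_^ r) (lem₂ F n c) ⟩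
      (F * c * n ^ 2) ^ r                ∎
      where
      c = 2 * r ^ r
      n²≤ : n * n ≤ n ^ r
      n²≤ = ≤-trans (≤-reflexive (cong (n *_) (sym (*-identityʳ n))))
              (^-monoʳ-≤ n (s≤s (≤-trans (s≤s z≤n) (m≤n+m q q′))))
      lem₁ : ∀ x c n → x * (c * n) * n ≡ x * c * (n * n)
      lem₁ = solve-∀
      lem₂ : ∀ F n c → F * n * c * n ≡ F * c * (n * (n * 1))
      lem₂ = solve-∀

    -- Bounds under an `r`-th power do not add, so `t + u` is replaced by twice the larger summand.
    sum-bound : ∀ x y {t u} → t ^ r * n ≤ (x * n ^ 2) ^ r → u ^ r * n ≤ (y * n ^ 2) ^ r →
                (t + u) ^ r * n ≤ (2 * (x + y) * n ^ 2) ^ r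
    sum-bound x y {t} {u} t≤ u≤ = case (≤-total t u)
      where
      twice : ∀ v z → t + u ≤ v + v → v ^ r * n ≤ (z * n ^ 2) ^ r → z ≤ x + y →
              (t + u) ^ r * n ≤ (2 * (x + y) * n ^ 2) ^ r
      twice v z ≤2v v≤ z≤ = begin
        (t + u) ^ r * n                ≤⟨ *-monoˡ-≤ n (^-monoˡ-≤ r ≤2v) ⟩
        (v + v) ^ r * n                ≡⟨ cong (λ x → (v + x) ^ r * n) (+-identityʳ v) ⟨
        (2 * v) ^ r * n                ≡⟨ cong (_* n) (*-^-distrib 2 v r) ⟩
        2 ^ r * v ^ r * n              ≡⟨ *-assoc (2 ^ r) (v ^ r) n ⟩
        2 ^ r * (v ^ r * n)            ≤⟨ *-monoʳ-≤ (2 ^ r) v≤ ⟩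
        2 ^ r * (z * n ^ 2) ^ r        ≡⟨ *-^-distrib 2 (z * n ^ 2) r ⟨
        (2 * (z * n ^ 2)) ^ r          ≡⟨ cong (_^ r) (*-assoc 2 z (n ^ 2)) ⟨
        (2 * z * n ^ 2) ^ r            ≤⟨ ^-monoˡ-≤ r (*-monoˡ-≤ (n ^ 2) (*-monoʳ-≤ 2 z≤)) ⟩
        (2 * (x + y) * n ^ 2) ^ r      ∎
      case : t ≤ u ⊎ u ≤ t → (t + u) ^ r * n ≤ (2 * (x + y) * n ^ 2) ^ r
      case (inj₁ t≤u) = twice u y (+-monoˡ-≤ u t≤u) u≤ (m≤n+m y x)
      case (inj₂ u≤t) = twice t x (+-monoʳ-≤ t u≤t) t≤ (m≤m+n x y)

  1≤num : ∀ {q} → 0ℚᵘ ℚ.< q → 1 ≤ num q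
  1≤num {q} 0<q with q | positive {q} 0<q
  ... | mkℚᵘ (ℤ.+ suc n) _ | _ = s≤s z≤n

  -- For a positive p/q this is 1/(2q): half of 1/q ≤ p/q goes to the logarithms.
  halved : ℚᵘ → ℚᵘ
  halved (mkℚᵘ _ q′) = mkℚᵘ (ℤ.+ 1) (q′ + suc q′)

  halved-positive : ∀ q → 0ℚᵘ ℚ.< halved q
  halved-positive (mkℚᵘ _ q′) = *<* (ℤ.+<+ (s≤s z≤n))

  -- Size of the constructed instance, word size and time bounds

  module Estimates (κ : ℚᵘ) (1≤κ : 1 ≤ num κ) {c : ℕ} (I : OVInstance c) where
    open OVInstance I using (n; d; n≥1)
    open Extended I
    open Construction κ 1≤κ {n} {d} n≥1 ext ext≤1 (λ _ → refl)
    open ≤-Reasoning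

    M e a b β U X : ℕ
    M = num κ
    e = 2 + c
    a = 20 * M * e + 3
    b = bits n
    β = 2 ^ b
    U = m * 2
    X = U * suc n

    instance
      b≢0 : NonZero b
      b≢0 = >-nonZero (1≤bits n≥1)
      n≢0 : NonZero n
      n≢0 = >-nonZero n≥1
      M≢0 : NonZero M
      M≢0 = >-nonZero 1≤κ
      β≢0 : NonZero β
      β≢0 = m^n≢0 2 b

    D≤ : D ≤ e * b
    D≤ = begin
      2 + c * ⌈log₂ n ⌉  ≤⟨ +-mono-≤ (m≤m*n 2 b) (*-monoʳ-≤ c (⌈log₂⌉-mono-≤ (n≤1+n n))) ⟩
      2 * b + c * b      ≡⟨ *-distribʳ-+ b 2 c ⟨
      e * b              ∎

    -- This is the origin of `a`: `5 * X` is `20 * M * (n * D * suc n)`, the last three factors are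
    -- at most `e * β ^ 3`, and `20 * M * e` is absorbed as an exponent of `β ≥ 2`.
    5X≤ : 5 * X ≤ β ^ a
    5X≤ = begin
      5 * (M * (n * D + D * n) * 2 * suc n)            ≡⟨ lem₁ M n D (suc n) ⟩
      20 * M * (n * D * suc n)
        ≤⟨ *-monoʳ-≤ (20 * M) (*-mono-≤ (*-mono-≤ n≤β D≤eβ) (n<2^bits n)) ⟩
      20 * M * (β * (e * β) * β)                        ≡⟨ lem₂ M e β ⟩
      20 * M * e * β ^ 3                                ≤⟨ *-monoˡ-≤ (β ^ 3) small ⟩
      β ^ (20 * M * e) * β ^ 3                          ≡⟨ ^-distribˡ-+-* β (20 * M * e) 3 ⟨
      β ^ a                                             ∎
      where
      n≤β = <⇒≤ (n<2^bits n)
      D≤eβ = ≤-trans D≤ (*-monoʳ-≤ e (n≤2^n b))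
      2≤β : 2 ≤ β
      2≤β = ^-monoʳ-≤ 2 (1≤bits n≥1)
      small : 20 * M * e ≤ β ^ (20 * M * e)
      small = ≤-trans (n≤2^n _) (^-monoˡ-≤ (20 * M * e) 2≤β)
      lem₁ : ∀ M n D s → 5 * (M * (n * D + D * n) * 2 * s) ≡ 20 * M * (n * D * s)
      lem₁ = solve-∀
      lem₂ : ∀ M e β → 20 * M * (β * (e * β) * β) ≡ 20 * M * e * (β * (β * (β * 1)))
      lem₂ = solve-∀

    size-instance : ℕ
    size-instance = N + σ + grammarSize G + m

    σ≤X : σ ≤ X
    σ≤X = begin
      M * (n * D * n)                      ≡⟨ *-assoc M (n * D) n ⟨
      M * (n * D) * n                      ≤⟨ *-mono-≤
        (≤-trans (*-monoʳ-≤ M (m≤m+n (n * D) (D * n))) (m≤m*n m 2)) (n≤1+n n) ⟩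
      X                                    ∎

    m≤X : m ≤ X
    m≤X = ≤-trans (m≤m*n m 2) (m≤m*n U (suc n))

    size-G≤m : grammarSize G ≤ m
    size-G≤m = ≤-trans (≤-reflexive size-G) (m≤n*m _ M)

    n≤size-G : n ≤ grammarSize G
    n≤size-G = ≤-trans (m≤m*n n D) (≤-trans (m≤m+n (n * D) (D * n)) (≤-reflexive (sym size-G)))

    -- Each of the four summands is at most `X`; the fifth `X`, being positive, makes the inequality
    -- strict.
    size< : size-instance < 5 * X
    size< = ≤-trans
      (s≤s (+-mono-≤ (+-mono-≤ (+-mono-≤ (≤-trans N≤σ σ≤X) σ≤X) (≤-trans size-G≤m m≤X)) m≤X))
      (≤-trans (+-monoˡ-≤ (X + X + X + X) (≤-trans n≥1 (≤-trans n≤size-G (≤-trans size-G≤m m≤X))))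
        (≤-reflexive (lem X)))
      where
      lem : ∀ X → X + (X + X + X + X) ≡ 5 * X
      lem = solve-∀

    X≤ : X ≤ β ^ a
    X≤ = ≤-trans (m≤n*m X 5) 5X≤

    bits-size≤ : bits size-instance ≤ b * a
    bits-size≤ = begin
      ⌈log₂ suc size-instance ⌉  ≤⟨ ⌈log₂⌉-mono-≤ (≤-trans size< 5X≤) ⟩
      ⌈log₂ β ^ a ⌉              ≡⟨ cong ⌈log₂_⌉ (^-*-assoc 2 b a) ⟩
      ⌈log₂ 2 ^ (b * a) ⌉        ≡⟨ ⌈log₂2^n⌉≡n (b * a) ⟩
      b * a                      ∎

    b≤bits-size : b ≤ bits size-instance
    b≤bits-size = ⌈log₂⌉-mono-≤ (s≤s (≤-trans n≤size-G
      (≤-trans (m≤n+m (grammarSize G) (N + σ)) (m≤m+n _ m))))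

    log-N≤ : ⌊log₂ N ⌋ ≤ a * b
    log-N≤ = begin
      ⌊log₂ N ⌋            ≤⟨ ⌊log₂⌋-mono-≤ (≤-trans (≤-trans N≤σ σ≤X) X≤) ⟩
      ⌊log₂ β ^ a ⌋        ≡⟨ cong ⌊log₂_⌋ (^-*-assoc 2 b a) ⟩
      ⌊log₂ 2 ^ (b * a) ⌋  ≡⟨ ⌊log₂[2^n]⌋≡n (b * a) ⟩
      b * a                ≡⟨ *-comm b a ⟩
      a * b                ∎

    -- `k₀ * a` gives the called program its words, as the logarithm of the new size is at most
    -- `a * b`. `a * 200` makes room for `X ^ 200`, and the final 1 makes that bound strict.
    wordSize : ℕ → ℕ
    wordSize k₀ = k₀ * a + a * 200 + 1

    wide-enough : ∀ {k₀ w} → wordSize k₀ * b ≤ w → k₀ * bits size-instance ≤ w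
    wide-enough {k₀} {w} ≤w = begin
      k₀ * bits size-instance   ≤⟨ *-monoʳ-≤ k₀ bits-size≤ ⟩
      k₀ * (b * a)              ≡⟨ trans (cong (k₀ *_) (*-comm b a)) (sym (*-assoc k₀ a b)) ⟩
      k₀ * a * b                ≤⟨ *-monoˡ-≤ b (≤-trans (m≤m+n (k₀ * a) (a * 200)) (m≤m+n _ 1)) ⟩
      wordSize k₀ * b           ≤⟨ ≤w ⟩
      w                         ∎

    X^200<2^w : ∀ k₀ {w} → wordSize k₀ * b ≤ w → X ^ 200 < 2 ^ w
    X^200<2^w k₀ {w} ≤w = ≤-<-trans
      (≤-trans (^-monoˡ-≤ 200 X≤)
        (≤-reflexive (trans (cong (_^ 200) (^-*-assoc 2 b a)) (^-*-assoc 2 (b * a) 200))))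
      (^-monoʳ-< 2 (s≤s (s≤s z≤n)) (begin
        suc (b * a * 200)           ≡⟨ +-comm 1 _ ⟩
        b * a * 200 + 1             ≤⟨ +-monoʳ-≤ (b * a * 200) (1≤bits n≥1) ⟩
        b * a * 200 + b             ≡⟨ lem b a 200 ⟩
        (a * 200 + 1) * b           ≤⟨ *-monoˡ-≤ b (m≤n+m (a * 200 + 1) (k₀ * a)) ⟩
        (k₀ * a + (a * 200 + 1)) * b ≡⟨ cong (_* b) (+-assoc (k₀ * a) (a * 200) 1) ⟨
        wordSize k₀ * b             ≤⟨ ≤w ⟩
        w                           ∎))
      where
      lem : ∀ b a s → b * a * s + b ≡ (a * s + 1) * b
      lem = solve-∀

    query-time : ∀ {ε C k t} → 1 ≤ num ε → RangeModeWithin ε (C , k) instance′ t →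
      t ^ den ε * n ≤ (C * (4 * M * (e * e) * a ^ k) * (n ^ 2 * b ^ (2 + k))) ^ den ε
    query-time {ε} {C} {k} {t} 1≤ε within = begin
      -- Of the saving `|G| ^ num ε` only one factor `n ≤ |G|` is kept, which suffices for an
      -- exponent `1 / den ε`.
      t ^ den ε * n                         ≤⟨ *-monoʳ-≤ (t ^ den ε) n≤ ⟩
      t ^ den ε * grammarSize G ^ num ε     ≤⟨ within ⟩
      (C * (m * grammarSize G * ⌊log₂ N ⌋ ^ k)) ^ den ε
        ≤⟨ ^-monoˡ-≤ (den ε) (*-monoʳ-≤ C bound) ⟩
      (C * (E * (n ^ 2 * b ^ (2 + k)))) ^ den ε
        ≡⟨ cong (_^ den ε) (*-assoc C E _) ⟨
      (C * E * (n ^ 2 * b ^ (2 + k))) ^ den ε ∎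
      where
      E = 4 * M * (e * e) * a ^ k
      g = grammarSize G
      instance
        g≢0 : NonZero g
        g≢0 = >-nonZero (≤-trans n≥1 n≤size-G)
      n≤ : n ≤ g ^ num ε
      n≤ = ≤-trans n≤size-G (≤-trans (≤-reflexive (sym (^-identityʳ g))) (^-monoʳ-≤ g 1≤ε))
      lem₁ : ∀ M n D L → M * (n * D + D * n) * (n * D + D * n) * L ≡ 4 * M * (n * n) * (D * D) * L
      lem₁ = solve-∀
      lem₂ : ∀ M n e b A B → 4 * M * (n * n) * (e * b * (e * b)) * (A * B) ≡
                             4 * M * (e * e) * A * (n * (n * 1) * (b * (b * B)))
      lem₂ = solve-∀
      bound : m * g * ⌊log₂ N ⌋ ^ k ≤ E * (n ^ 2 * b ^ (2 + k))
      bound = begin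
        m * g * ⌊log₂ N ⌋ ^ k
          ≡⟨ cong (λ g → m * g * ⌊log₂ N ⌋ ^ k) size-G ⟩
        m * (n * D + D * n) * ⌊log₂ N ⌋ ^ k
          ≡⟨ lem₁ M n D (⌊log₂ N ⌋ ^ k) ⟩
        4 * M * (n * n) * (D * D) * ⌊log₂ N ⌋ ^ k
          ≤⟨ *-mono-≤ (*-monoʳ-≤ (4 * M * (n * n)) (*-mono-≤ D≤ D≤)) (^-monoˡ-≤ k log-N≤) ⟩
        4 * M * (n * n) * (e * b * (e * b)) * (a * b) ^ k
          ≡⟨ cong (4 * M * (n * n) * (e * b * (e * b)) *_) (*-^-distrib a b k) ⟩
        4 * M * (n * n) * (e * b * (e * b)) * (a ^ k * b ^ k)
          ≡⟨ lem₂ M n e b (a ^ k) (b ^ k) ⟩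
        E * (n ^ 2 * b ^ (2 + k)) ∎

    overhead-time : ∀ {K u} → u ≤ K * U → u ≤ K * (4 * M * e) * (n * b)
    overhead-time {K} {u} u≤ = begin
      u                                    ≤⟨ u≤ ⟩
      K * (M * (n * D + D * n) * 2)        ≡⟨ lem₁ K M n D ⟩
      K * (4 * M) * (n * D)                ≤⟨ *-monoʳ-≤ (K * (4 * M)) (*-monoʳ-≤ n D≤) ⟩
      K * (4 * M) * (n * (e * b))          ≡⟨ lem₂ K M n e b ⟩
      K * (4 * M * e) * (n * b)            ∎
      where
      lem₁ : ∀ K M n D → K * (M * (n * D + D * n) * 2) ≡ K * (4 * M) * (n * D)
      lem₁ = solve-∀
      lem₂ : ∀ K M n e b → K * (4 * M) * (n * (e * b)) ≡ K * (4 * M * e) * (n * b)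
      lem₂ = solve-∀

  -- The reduction as a whole

  -- The program and the lower factor for `w` are fixed before `K`, which enters only through the
  -- constants of the given algorithm. The same `K` can be passed on, because the new instance is at
  -- least as large as the old one.
  solve-OV : ∀ ε κ → 1 ≤ num ε → (1≤κ : 1 ≤ num κ) →
    SolvableWithin (RangeMode κ) (RangeModeWithin ε) → ∀ c → SolvableWithin (OV c) (OVWithin (halved ε))
  solve-OV ε@(mkℚᵘ _ q′) κ 1≤ε 1≤κ (prog , k₀ , solves) c =
    program , k₀ * a + a * 200 + 1 , λ K → constant (proj₁ (solves K)) ,
    λ I w ≤w w≤ → solution K I ≤w w≤
    where
    open Reduction κ 1≤κ prog
    M e a r : ℕ
    M = num κ
    e = 2 + c
    a = 20 * M * e + 3
    r = suc q′ + suc q′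
    queryConstant : ℕ × ℕ → ℕ
    queryConstant (C , k) = C * (4 * M * (e * e) * a ^ k) * (2 * ((2 + k) * r) ^ ((2 + k) * r))
    overheadConstant : ℕ
    overheadConstant = (preparationBound + scanBound) * (4 * M * e) * (2 * r ^ r)
    constant : ℕ × ℕ → ℕ
    constant γ = 2 * (queryConstant γ + overheadConstant)
    solution : ∀ K (I : OVInstance c) {w} → (k₀ * a + a * 200 + 1) * bits (OVInstance.n I) ≤ w →
      w ≤ K * bits (OVInstance.n I) →
      Σ State λ s → Σ ℕ λ t → WordRAM.Exec w program (WordRAM.initial w (encodeOV I)) s t
      × Problem.Correct (OV c) I (mem s) × OVWithin (halved ε) (constant (proj₁ (solves K))) I t
    solution K I {w} ≤w w≤ = answerWith (proj₁ (solves K)) (proj₂ (solves K) instance′ w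
        (wide-enough {k₀} ≤w) (≤-trans w≤ (*-monoʳ-≤ K b≤bits-size)))
      where
      open Estimates κ 1≤κ I using (wide-enough; b≤bits-size; X^200<2^w; query-time; overhead-time)
      open Simulation I using (simulate; answers; module Simulated; _≲_)
      open OVInstance I using (n; d; n≥1)
      open Extended I
      open Construction κ 1≤κ {n} {d} n≥1 ext ext≤1 (λ _ → refl) using (instance′)
      answerWith : ∀ γ →
        (Σ State λ s → Σ ℕ λ t → WordRAM.Exec w prog (WordRAM.initial w (encodeRangeMode instance′)) s t
         × Problem.Correct (RangeMode κ) instance′ (mem s) × RangeModeWithin ε γ instance′ t) →
        Σ State λ s → Σ ℕ λ t → WordRAM.Exec w program (WordRAM.initial w (encodeOV I)) s t
        × Problem.Correct (OV c) I (mem s) × OVWithin (halved ε) (constant γ) I t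
      answerWith (C , k) (s , t , executed , correct , within) =
        S.s , _ , S.executed , S.decided ,
        -- The numerator of `halved ε` is 1, so the goal contains `n ^ 1`, that is `n * 1`.
        subst (λ x → (t + S.u) ^ r * x ≤ (constant (C , k) * n ^ 2) ^ r) (sym (*-identityʳ n))
          (sum-bound n≥1 q′ (queryConstant (C , k)) overheadConstant {t} {S.u}
            (subquadratic n≥1 q′ (C * (4 * M * (e * e) * a ^ k)) (2 + k) {t}
              (query-time {ε} {C} {k} {t} 1≤ε within))
            (quasilinear n≥1 q′ ((preparationBound + scanBound) * (4 * M * e)) {S.u}
              (overhead-time {preparationBound + scanBound} {S.u} (_≲_.≲-elim S.overhead))))
        where
        wide = X^200<2^w k₀ {w} ≤w
        module S = Simulated {w} {wide} {t} (simulate {w} wide executed (answers {w} wide {mem s} correct))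

open import Data.Rational.Unnormalised using (_<_)

theorem1p9 : OrthogonalVectorsConjecture →
    (ε : ℚᵘ) → 0ℚᵘ < ε → (κ : ℚᵘ) → 0ℚᵘ < κ →
    ¬ SolvableWithin (RangeMode κ) (RangeModeWithin ε)
-- The conjecture picks `c` after seeing the halved exponent; the reduction works for every `c`.
theorem1p9 conjecture ε 0<ε κ 0<κ solvable with conjecture (halved ε) (halved-positive ε)
... | c , _ , unsolvable = unsolvable (solve-OV ε κ (1≤num 0<ε) (1≤num 0<κ) solvable c)
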